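{- Let $r,c,n$ be integers with $0\le r\le c\le n$, and let $M=M(n;r,c)$ and $M^*$ be the matrices defined in the context. Then $M^*$ is the Moore-Penrose inverse of $M$, i.e. $M^+=M^*$.
   Context: Let $[n]=\{1,\dots,n\}$. The set inclusion incidence matrix $M=M(n;r,c)$ is the $\binom{n}{r}\times\binom{n}{c}$ real matrix whose rows are indexed by the $r$-subsets $R$ of $[n]$, whose columns are indexed by the $c$-subsets $C$ of $[n]$, and whose $(R,C)$-entry is $1$ if $R\subseteq C$ and $0$ otherwise. Let $N=\max\{n,r+c\}$. Let $M^*$ be the $\binom{n}{c}\times\binom{n}{r}$ matrix with rows indexed by $c$-subsets $C$ and columns indexed by $r$-subsets $R$ of $[n]$, with entries $$M^*_{C,R}=(-1)^{r-i}\frac{\binom{c-i-1}{r-i}}{\binom{N-r}{c-r}\binom{N-c}{r-i}},\qquad i=|R\cap C|.$$ Binomial coefficients $\binom{a}{b}$ with integer $a$ and integer $b\ge 0$ are understood as $a(a-1)\cdots(a-b+1)/b!$ (so e.g. $\binom{ -1}{0}=1$). The Moore-Penrose inverse $A^+$ of a real $m\times n$ matrix $A$ is the unique $n\times m$ matrix $G$ with $AGA=A$, $GAG=G$, $(AG)^T=AG$, $(GA)^T=GA$. -}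

module Defs where

open import Data.Bool using (Bool; true; false; if_then_else_)
open import Data.Nat as ℕ using (ℕ; zero; suc; _∸_; _⊔_; _≡ᵇ_; _!)
open import Data.Nat.Properties using (_!≢0)
open import Data.Nat.Combinatorics using (_C_)
open import Data.Integer as ℤ using (ℤ; +_)
open import Data.Rational using (ℚ; 0ℚ; 1ℚ; _+_; _*_; -_; _/_)
open import Data.List using (List; []; _∷_; [_]; map; _++_; foldr)
open import Data.Vec using (Vec; []; _∷_)
open import Data.Fin.Subset using (Subset; inside; outside; ∣_∣; _∩_)
open import Data.Fin.Subset.Properties using (_⊆?_)
open import Relation.Nullary.Decidable using (⌊_⌋)
open import Relation.Binary.PropositionalEquality using (_≡_)

allSubsets : (n : ℕ) → List (Subset n)
allSubsets zero    = [ [] ]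
allSubsets (suc n) = map (outside ∷_) (allSubsets n) ++ map (inside ∷_) (allSubsets n)

sumSized : (n k : ℕ) → (Subset n → ℚ) → ℚ
sumSized n k f = foldr (λ S acc → (if ∣ S ∣ ≡ᵇ k then f S else 0ℚ) + acc) 0ℚ (allSubsets n)

-- A matrix whose rows/columns are indexed by subsets of [n]
-- (only entries at rows/columns of the relevant sizes matter).
Mat : ℕ → Set
Mat n = Subset n → Subset n → ℚ

mul : (n k : ℕ) → Mat n → Mat n → Mat n
mul n k A B X Y = sumSized n k (λ Z → A X Z * B Z Y)

transpose : ∀ {n} → Mat n → Mat n
transpose A X Y = A Y X

MatEq : (n a b : ℕ) → Mat n → Mat n → Set
MatEq n a b A B = (X Y : Subset n) → ∣ X ∣ ≡ a → ∣ Y ∣ ≡ b → A X Y ≡ B X Y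

IsMoorePenroseInverse : (n r c : ℕ) → Mat n → Mat n → Set
IsMoorePenroseInverse n r c A G =
  MatEq n r c (mul n r (mul n c A G) A) A ×′
  (MatEq n c r (mul n c (mul n r G A) G) G ×′
  (MatEq n r r (transpose (mul n c A G)) (mul n c A G) ×′
   MatEq n c c (transpose (mul n r G A)) (mul n r G A)))
  where
  open import Data.Product using () renaming (_×_ to _×′_)

falling : ℤ → ℕ → ℤ
falling a zero    = ℤ.+ 1
falling a (suc b) = falling a b ℤ.* (a ℤ.- (+ b))

binomℤ : ℤ → ℕ → ℚ
binomℤ a b = (falling a b / (b !)) {{b !≢0}}

-- q / d for a natural d (total; returns 0 when d = 0, which never occurs below
-- under the hypotheses 0 ≤ r ≤ c ≤ n).
divℕ : ℚ → ℕ → ℚ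
divℕ q zero    = 0ℚ
divℕ q (suc d) = q * (+ 1 / suc d)

inclM : (n r c : ℕ) → Mat n
inclM n r c S T = if ⌊ S ⊆? T ⌋ then 1ℚ else 0ℚ

signℚ : ℕ → ℚ
signℚ zero    = 1ℚ
signℚ (suc k) = - signℚ k

Mstar : (n r c : ℕ) → Mat n
Mstar n r c T S =
  divℕ (signℚ (r ∸ i) * binomℤ ((+ c) ℤ.- (+ i) ℤ.- (+ 1)) (r ∸ i))
       (((N ∸ r) C (c ∸ r)) ℕ.* ((N ∸ c) C (r ∸ i)))
  where
  N = n ⊔ (r ℕ.+ c)
  i = ∣ S ∩ T ∣

{-# OPTIONS --safe #-}
-- A sum over subsets Z of a function of ∣ Z ∣ and ∣ Y ∩ Z ∣, with Z restricted to contain X or to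
-- be contained in X, depends only on the cardinalities of the Venn diagram of X and Y.  Hence
-- M M* and M* M are symmetric, and it suffices to show M M* = I if n ≥ r + c and M* M = I if
-- n ≤ r + c.  With m = c ∸ r, q = N ∸ c and a = ∣ X ∖ Y ∣ = ∣ Y ∖ X ∣ for the two index sets
-- X and Y, both reduce to one alternating sum
--   Σₖ (-1)ᵏ C(a,k) C(m+q-a, q-k) C(m+k-1, k) / C(q,k),
-- in which the product of the last three factors is a constant times C(m+k-1, a-1), a polynomial
-- in k of degree a - 1; its a-th finite difference vanishes for a > 0.
module Submission where

open import Defs
open import Data.Bool using (Bool; true; false; if_then_else_; _∧_; _∨_; not)
open import Data.Empty using (⊥-elim)
open import Data.Fin.Subset using (Subset; inside; outside; ∣_∣; _∩_; ∁)
open import Data.Fin.Subset.Properties using (_⊆?_; ∩-comm; ∣p∩q∣≤∣p∣)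
open import Data.Integer as ℤ using (+_)
import Data.Integer.Properties as ℤₚ
open import Data.List using (List; []; _∷_; map; _++_; foldr)
open import Data.List.Properties using (foldr-map)
open import Data.Nat as ℕ using (ℕ; zero; suc; _≤_; _<_; z≤n; s≤s; _∸_; _⊔_; _≡ᵇ_; _!)
open import Data.Nat.Combinatorics using (_C_; nCk≡n!/k![n-k]!; k![n∸k]!∣n!; k>n⇒nCk≡0; nCk+nC[k+1]≡[n+1]C[k+1]; nCk≡nC[n∸k])
open import Data.Nat.DivMod using (m/n*n≡m)
import Data.Nat.Properties as ℕₚ
open import Data.Nat.Tactic.RingSolver using (solve-∀)
open import Data.Product using (_,_)
open import Data.Rational using (ℚ; 0ℚ; 1ℚ; _+_; _*_; -_; _/_; toℚᵘ; fromℚᵘ)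
open import Data.Rational.Properties
open import Data.Rational.Solver using (module +-*-Solver)
open import Data.Rational.Unnormalised as ℚᵘ using (mkℚᵘ; *≡*)
import Data.Rational.Unnormalised.Properties as ℚᵘₚ
open import Data.Sum using (inj₁; inj₂)
open import Data.Vec using ([]; _∷_)
open import Relation.Binary.PropositionalEquality
open import Relation.Nullary.Decidable using (Dec; ⌊_⌋; does; isYes≗does; yes; no)

open +-*-Solver using (solve; _:+_; _:*_; :-_; _:=_; con)

-- Natural numbers inside ℚ

ι : ℕ → ℚ
ι n = + n / 1

-- Arithmetic with `_/_` is carried out on unnormalised rationals, where equality is
-- cross-multiplication; `ι m` unfolds to the image of `mkℚᵘ (+ m) 0`.
fromℚᵘ-homo-* : ∀ p q → fromℚᵘ (p ℚᵘ.* q) ≡ fromℚᵘ p * fromℚᵘ q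
fromℚᵘ-homo-* p q = toℚᵘ-injective (begin
  toℚᵘ (fromℚᵘ (p ℚᵘ.* q))               ≈⟨ toℚᵘ-fromℚᵘ (p ℚᵘ.* q) ⟩
  p ℚᵘ.* q                               ≈⟨ ℚᵘₚ.*-cong (toℚᵘ-fromℚᵘ p) (toℚᵘ-fromℚᵘ q) ⟨
  toℚᵘ (fromℚᵘ p) ℚᵘ.* toℚᵘ (fromℚᵘ q)   ≈⟨ toℚᵘ-homo-* (fromℚᵘ p) (fromℚᵘ q) ⟨
  toℚᵘ (fromℚᵘ p * fromℚᵘ q)             ∎)
  where open import Relation.Binary.Reasoning.Setoid ℚᵘₚ.≃-setoid

fromℚᵘ-homo-+ : ∀ p q → fromℚᵘ (p ℚᵘ.+ q) ≡ fromℚᵘ p + fromℚᵘ q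
fromℚᵘ-homo-+ p q = toℚᵘ-injective (begin
  toℚᵘ (fromℚᵘ (p ℚᵘ.+ q))               ≈⟨ toℚᵘ-fromℚᵘ (p ℚᵘ.+ q) ⟩
  p ℚᵘ.+ q                               ≈⟨ ℚᵘₚ.+-cong (toℚᵘ-fromℚᵘ p) (toℚᵘ-fromℚᵘ q) ⟨
  toℚᵘ (fromℚᵘ p) ℚᵘ.+ toℚᵘ (fromℚᵘ q)   ≈⟨ toℚᵘ-homo-+ (fromℚᵘ p) (fromℚᵘ q) ⟨
  toℚᵘ (fromℚᵘ p + fromℚᵘ q)             ∎)
  where open import Relation.Binary.Reasoning.Setoid ℚᵘₚ.≃-setoid

ι-* : ∀ m n → ι (m ℕ.* n) ≡ ι m * ι n
ι-* m n = trans
  (fromℚᵘ-cong {mkℚᵘ (+ (m ℕ.* n)) 0} {mkℚᵘ (+ m) 0 ℚᵘ.* mkℚᵘ (+ n) 0}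
    (*≡* (cong (ℤ._* + 1) (ℤₚ.pos-* m n))))
  (fromℚᵘ-homo-* (mkℚᵘ (+ m) 0) (mkℚᵘ (+ n) 0))

ι-+ : ∀ m n → ι (m ℕ.+ n) ≡ ι m + ι n
ι-+ m n = trans
  (fromℚᵘ-cong {mkℚᵘ (+ (m ℕ.+ n)) 0} {mkℚᵘ (+ m) 0 ℚᵘ.+ mkℚᵘ (+ n) 0}
    (*≡* (cong (ℤ._* + 1) (trans (ℤₚ.pos-+ m n)
      (cong₂ ℤ._+_ (sym (ℤₚ.*-identityʳ (+ m))) (sym (ℤₚ.*-identityʳ (+ n))))))))
  (fromℚᵘ-homo-+ (mkℚᵘ (+ m) 0) (mkℚᵘ (+ n) 0))

[x*d]/d≡x : ∀ x d .{{_ : ℕ.NonZero d}} → + (x ℕ.* d) / d ≡ ι x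
[x*d]/d≡x x (suc d) = fromℚᵘ-cong {mkℚᵘ (+ (x ℕ.* suc d)) d} {mkℚᵘ (+ x) 0}
  (*≡* (trans (ℤₚ.*-identityʳ _) (ℤₚ.pos-* x (suc d))))

ι*1/ : ∀ d → ι (suc d) * (+ 1 / suc d) ≡ 1ℚ
ι*1/ d = trans (sym (fromℚᵘ-homo-* (mkℚᵘ (+ suc d) 0) (mkℚᵘ (+ 1) d)))
  (fromℚᵘ-cong {mkℚᵘ (+ suc d) 0 ℚᵘ.* mkℚᵘ (+ 1) d} {mkℚᵘ (+ 1) 0}
    (*≡* (cong +_ (solve′ d))))
  where
  solve′ : ∀ d → suc d ℕ.* 1 ℕ.* 1 ≡ 1 ℕ.* (1 ℕ.* suc d)
  solve′ = solve-∀

divℕ-*ι : ∀ x d .{{_ : ℕ.NonZero d}} → divℕ x d * ι d ≡ x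
divℕ-*ι x (suc d) = begin
  x * (+ 1 / suc d) * ι (suc d)    ≡⟨ *-assoc x _ _ ⟩
  x * ((+ 1 / suc d) * ι (suc d))  ≡⟨ cong (x *_) (trans (*-comm _ (ι (suc d))) (ι*1/ d)) ⟩
  x * 1ℚ                           ≡⟨ *-identityʳ x ⟩
  x                                ∎
  where open ≡-Reasoning

*ι-cancel : ∀ d .{{_ : ℕ.NonZero d}} x y → x * ι d ≡ y * ι d → x ≡ y
*ι-cancel (suc d) x y eq = begin
  x                                ≡⟨ expand x ⟨
  x * ι (suc d) * (+ 1 / suc d)    ≡⟨ cong (_* (+ 1 / suc d)) eq ⟩
  y * ι (suc d) * (+ 1 / suc d)    ≡⟨ expand y ⟩
  y                                ∎
  where
  open ≡-Reasoning
  expand : ∀ x → x * ι (suc d) * (+ 1 / suc d) ≡ x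
  expand x = trans (*-assoc x _ _) (trans (cong (x *_) (ι*1/ d)) (*-identityʳ x))

divℕ-0 : ∀ d → divℕ 0ℚ d ≡ 0ℚ
divℕ-0 zero    = refl
divℕ-0 (suc d) = *-zeroˡ (+ 1 / suc d)

-- Binomial coefficients

C-factorial : ∀ u v → ((u ℕ.+ v) C v) ℕ.* (v ! ℕ.* u !) ≡ (u ℕ.+ v) !
C-factorial u v = subst (λ w → ((u ℕ.+ v) C v) ℕ.* (v ! ℕ.* w !) ≡ (u ℕ.+ v) !) (ℕₚ.m+n∸n≡m u v)
  (trans (cong (ℕ._* (v ! ℕ.* (u ℕ.+ v ∸ v) !)) (nCk≡n!/k![n-k]! v≤))
         (m/n*n≡m {{v ℕₚ.!* (u ℕ.+ v ∸ v) !≢0}} (k![n∸k]!∣n! v≤)))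
  where v≤ = ℕₚ.m≤n+m v u

C-factorial′ : ∀ u v → ((v ℕ.+ u) C v) ℕ.* (v ! ℕ.* u !) ≡ (v ℕ.+ u) !
C-factorial′ u v = subst (λ w → (w C v) ℕ.* (v ! ℕ.* u !) ≡ w !) (ℕₚ.+-comm u v) (C-factorial u v)

C≢0 : ∀ u v → ℕ.NonZero ((u ℕ.+ v) C v)
C≢0 u v = ℕₚ.m*n≢0⇒m≢0 _ {{subst ℕ.NonZero (sym (C-factorial u v)) ((u ℕ.+ v) ℕₚ.!≢0)}}

n-C-0 : ∀ n → n C 0 ≡ 1
n-C-0 zero    = refl
n-C-0 (suc n) = refl

-- The last factor of the falling factorial is `p + 1`, and it is absorbed into `p !`; hence `p` has
-- to vary in the induction on `k`.
falling-factorial : ∀ p k → falling (+ (p ℕ.+ k)) k ℤ.* + (p !) ≡ + ((p ℕ.+ k) !)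
falling-factorial p zero    = trans (ℤₚ.*-identityˡ _) (cong (λ x → + (x !)) (sym (ℕₚ.+-identityʳ p)))
falling-factorial p (suc k) = begin
  F ℤ.* (+ (p ℕ.+ suc k) ℤ.- + k) ℤ.* + (p !)  ≡⟨ ℤₚ.*-assoc F _ _ ⟩
  F ℤ.* ((+ (p ℕ.+ suc k) ℤ.- + k) ℤ.* + (p !))≡⟨ cong (λ x → F ℤ.* (x ℤ.* + (p !))) diff ⟩
  F ℤ.* (+ suc p ℤ.* + (p !))                  ≡⟨ cong (F ℤ.*_) (ℤₚ.pos-* (suc p) (p !)) ⟨
  F ℤ.* + (suc p !)                            ≡⟨ cong (λ x → falling (+ x) k ℤ.* + (suc p !)) (ℕₚ.+-suc p k) ⟩
  falling (+ (suc p ℕ.+ k)) k ℤ.* + (suc p !)  ≡⟨ falling-factorial (suc p) k ⟩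
  + ((suc p ℕ.+ k) !)                          ≡⟨ cong (λ x → + (x !)) (ℕₚ.+-suc p k) ⟨
  + ((p ℕ.+ suc k) !)                          ∎
  where
  open ≡-Reasoning
  F = falling (+ (p ℕ.+ suc k)) k
  diff : + (p ℕ.+ suc k) ℤ.- + k ≡ + suc p
  diff = begin
    + (p ℕ.+ suc k) ℤ.- + k      ≡⟨ ℤₚ.[+m]-[+n]≡m⊖n (p ℕ.+ suc k) k ⟩
    (p ℕ.+ suc k) ℤ.⊖ k          ≡⟨ cong (ℤ._⊖ k) (ℕₚ.+-suc p k) ⟩
    (suc p ℕ.+ k) ℤ.⊖ k          ≡⟨ ℤₚ.⊖-≥ (ℕₚ.m≤n+m k (suc p)) ⟩
    + (suc p ℕ.+ k ∸ k)          ≡⟨ cong +_ (ℕₚ.m+n∸n≡m (suc p) k) ⟩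
    + suc p                      ∎

falling-C : ∀ p k → falling (+ (p ℕ.+ k)) k ≡ + (((p ℕ.+ k) C k) ℕ.* k !)
falling-C p k = ℤₚ.*-cancelʳ-≡ _ _ (+ (p !)) {{p ℕₚ.!≢0}} (begin
  falling (+ (p ℕ.+ k)) k ℤ.* + (p !)     ≡⟨ falling-factorial p k ⟩
  + ((p ℕ.+ k) !)                         ≡⟨ cong +_ (trans (ℕₚ.*-assoc ((p ℕ.+ k) C k) (k !) (p !)) (C-factorial p k)) ⟨
  + (((p ℕ.+ k) C k) ℕ.* k ! ℕ.* p !)       ≡⟨ ℤₚ.pos-* (((p ℕ.+ k) C k) ℕ.* k !) (p !) ⟩
  + (((p ℕ.+ k) C k) ℕ.* k !) ℤ.* + (p !)   ∎)
  where open ≡-Reasoning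

binomℤ-C : ∀ p k → binomℤ (+ (p ℕ.+ k)) k ≡ ι ((p ℕ.+ k) C k)
binomℤ-C p k = trans (cong (λ x → (x / (k !)) {{k ℕₚ.!≢0}}) (falling-C p k))
                     ([x*d]/d≡x ((p ℕ.+ k) C k) (k !) {{k ℕₚ.!≢0}})

-- The last factor of the falling factorial is `k - k`. This kills the entries with `k > 0` when
-- `m = 0`.
binomℤ-suc≡0 : ∀ k → binomℤ (+ k) (suc k) ≡ 0ℚ
binomℤ-suc≡0 k = trans (cong (λ x → (x / (suc k !)) {{suc k ℕₚ.!≢0}})
    (trans (cong (falling (+ k) k ℤ.*_) (ℤₚ.+-inverseʳ (+ k))) (ℤₚ.*-zeroʳ (falling (+ k) k))))
  ([x*d]/d≡x 0 (suc k !) {{suc k ℕₚ.!≢0}})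

-- After multiplication by `u ! v ! k !` both sides equal `(u + v)! (p + k)! (k + v)!`. Divided out,
-- it says that `C(u+v,v) C(p+k,k) / C(k+v,k)` is `C(p+k,b)` times a factor that does not depend on
-- `k` once `u + v` and `k + v` are fixed.
C-exchange : ∀ b p k u v → p ℕ.+ k ≡ b ℕ.+ u →
  ((u ℕ.+ v) C v) ℕ.* ((p ℕ.+ k) C k) ℕ.* (p ! ℕ.* (k ℕ.+ v) !) ≡
  (u ℕ.+ v) ! ℕ.* b ! ℕ.* (((k ℕ.+ v) C k) ℕ.* ((p ℕ.+ k) C b))
C-exchange b p k u v eq = ℕₚ.*-cancelʳ-≡ _ _ (u ! ℕ.* v ! ℕ.* k !)
    {{ℕₚ.m*n≢0 _ _ {{u ℕₚ.!* v !≢0}} {{k ℕₚ.!≢0}}}} (begin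
  _ ≡⟨ reorder₁ ((u ℕ.+ v) C v) ((p ℕ.+ k) C k) (p !) ((k ℕ.+ v) !) (u !) (v !) (k !) ⟩
  (((u ℕ.+ v) C v) ℕ.* (v ! ℕ.* u !)) ℕ.* (((p ℕ.+ k) C k) ℕ.* (k ! ℕ.* p !)) ℕ.* (k ℕ.+ v) !
    ≡⟨ cong₂ (λ x y → x ℕ.* y ℕ.* (k ℕ.+ v) !) (C-factorial u v) (C-factorial p k) ⟩
  (u ℕ.+ v) ! ℕ.* (p ℕ.+ k) ! ℕ.* (k ℕ.+ v) !
    ≡⟨ cong₂ (λ x y → (u ℕ.+ v) ! ℕ.* x ℕ.* y) C-b (C-factorial′ v k) ⟨
  (u ℕ.+ v) ! ℕ.* (((p ℕ.+ k) C b) ℕ.* (b ! ℕ.* u !)) ℕ.* (((k ℕ.+ v) C k) ℕ.* (k ! ℕ.* v !))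
    ≡⟨ reorder₂ ((u ℕ.+ v) !) ((p ℕ.+ k) C b) (b !) (u !) ((k ℕ.+ v) C k) (k !) (v !) ⟩
  _ ∎)
  where
  open ≡-Reasoning
  C-b : ((p ℕ.+ k) C b) ℕ.* (b ! ℕ.* u !) ≡ (p ℕ.+ k) !
  C-b = subst (λ w → (w C b) ℕ.* (b ! ℕ.* u !) ≡ w !) (sym eq) (C-factorial′ u b)
  reorder₁ : ∀ A B P Q U V K → A ℕ.* B ℕ.* (P ℕ.* Q) ℕ.* (U ℕ.* V ℕ.* K) ≡
                               (A ℕ.* (V ℕ.* U)) ℕ.* (B ℕ.* (K ℕ.* P)) ℕ.* Q
  reorder₁ = solve-∀
  reorder₂ : ∀ E X B U Y K V → E ℕ.* (X ℕ.* (B ℕ.* U)) ℕ.* (Y ℕ.* (K ℕ.* V)) ≡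
                               E ℕ.* B ℕ.* (Y ℕ.* X) ℕ.* (U ℕ.* V ℕ.* K)
  reorder₂ = solve-∀

-- Here `e` stands for `u + v`. If `b > p + k`, no such `u` exists, but then `e < v` as well and
-- both sides are zero.
C-exchange-total : ∀ b p k e v → e ℕ.+ b ≡ p ℕ.+ (k ℕ.+ v) →
  (e C v) ℕ.* ((p ℕ.+ k) C k) ℕ.* (p ! ℕ.* (k ℕ.+ v) !) ≡
  e ! ℕ.* b ! ℕ.* (((k ℕ.+ v) C k) ℕ.* ((p ℕ.+ k) C b))
C-exchange-total b p k e v eq with b ℕ.≤? p ℕ.+ k
... | yes b≤ = subst (λ e → (e C v) ℕ.* ((p ℕ.+ k) C k) ℕ.* (p ! ℕ.* (k ℕ.+ v) !) ≡
                             e ! ℕ.* b ! ℕ.* (((k ℕ.+ v) C k) ℕ.* ((p ℕ.+ k) C b)))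
                     (ℕₚ.+-cancelʳ-≡ b _ _ u+v+b) (C-exchange b p k u v (sym (ℕₚ.m+[n∸m]≡n b≤)))
  where
  u = p ℕ.+ k ∸ b
  swap : ∀ u v b → u ℕ.+ v ℕ.+ b ≡ (b ℕ.+ u) ℕ.+ v
  swap = solve-∀
  u+v+b : u ℕ.+ v ℕ.+ b ≡ e ℕ.+ b
  u+v+b = trans (swap u v b) (trans (cong (ℕ._+ v) (ℕₚ.m+[n∸m]≡n b≤)) (trans (ℕₚ.+-assoc p k v) (sym eq)))
... | no b≰ = trans (cong (λ x → x ℕ.* ((p ℕ.+ k) C k) ℕ.* (p ! ℕ.* (k ℕ.+ v) !)) (k>n⇒nCk≡0 e<v))
    (sym (trans (cong (λ x → e ! ℕ.* b ! ℕ.* (((k ℕ.+ v) C k) ℕ.* x)) (k>n⇒nCk≡0 (ℕₚ.≰⇒> b≰)))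
                (trans (cong (e ! ℕ.* b ! ℕ.*_) (ℕₚ.*-zeroʳ ((k ℕ.+ v) C k))) (ℕₚ.*-zeroʳ (e ! ℕ.* b !)))))
  where
  e<v : e < v
  e<v = ℕₚ.+-cancelʳ-< b e v (subst (ℕ._< v ℕ.+ b) (trans (ℕₚ.+-comm v _) (trans (ℕₚ.+-assoc p k v) (sym eq)))
          (ℕₚ.+-monoʳ-< v (ℕₚ.≰⇒> b≰)))

-- Iterated sums of neighbouring values

-- This is the sum of `C(a,i) h(j+i)` over `i`. When `h` carries alternating signs, it is an `a`-th
-- finite difference up to sign.
pascal : ℕ → (ℕ → ℚ) → ℕ → ℚ
pascal zero    h j = h j
pascal (suc a) h j = pascal a h j + pascal a h (suc j)

-- Binomial coefficients are symmetric: reflecting the index swaps the two summands of the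
-- recursion. The windows of length `s` starting at `j` and at `k` are mirror images inside
-- `0, ..., a`.
pascal-reverse : ∀ {a} {f g : ℕ → ℚ} → (∀ j k → j ℕ.+ k ≡ a → f j ≡ g k) →
  ∀ s j k → j ℕ.+ k ℕ.+ s ≡ a → pascal s f j ≡ pascal s g k
pascal-reverse fg zero    j k eq = fg j k (trans (sym (ℕₚ.+-identityʳ _)) eq)
pascal-reverse fg (suc s) j k eq = trans
  (cong₂ _+_ (pascal-reverse fg s j (suc k) (trans (move₁ j k s) eq))
             (pascal-reverse fg s (suc j) k (trans (move₂ j k s) eq)))
  (+-comm (pascal s _ (suc k)) (pascal s _ k))
  where
  move₁ : ∀ j k s → j ℕ.+ suc k ℕ.+ s ≡ j ℕ.+ k ℕ.+ suc s
  move₁ = solve-∀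
  move₂ : ∀ j k s → suc j ℕ.+ k ℕ.+ s ≡ j ℕ.+ k ℕ.+ suc s
  move₂ = solve-∀

-- By Pascal's rule, adding neighbours with opposite signs lowers the lower index by one and flips
-- the sign. The bound `k ≤ a` is kept because the values of `h` are known only there.
pascal-alternating : ∀ {a p} {K : ℚ} {h : ℕ → ℚ} s b →
  (∀ k → k ≤ a → h k ≡ K * (signℚ k * ι ((p ℕ.+ k) C (b ℕ.+ s)))) →
  ∀ k → k ℕ.+ s ≤ a → pascal s h k ≡ K * (signℚ (k ℕ.+ s) * ι ((p ℕ.+ k) C b))
pascal-alternating {a} {p} {K} zero b hyp k k≤ =
  trans (hyp k (subst (_≤ a) (ℕₚ.+-identityʳ k) k≤))
        (cong₂ (λ x y → K * (signℚ x * ι ((p ℕ.+ k) C y))) (sym (ℕₚ.+-identityʳ k)) (ℕₚ.+-identityʳ b))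
pascal-alternating {a} {p} {K} {h} (suc s) b hyp k k≤ = begin
  pascal s h k + pascal s h (suc k)
    ≡⟨ cong₂ _+_ (ih k (ℕₚ.≤-trans (ℕₚ.+-monoʳ-≤ k (ℕₚ.n≤1+n s)) k≤))
                 (ih (suc k) (subst (_≤ a) (ℕₚ.+-suc k s) k≤)) ⟩
  K * (σ * ι ((p ℕ.+ k) C suc b)) + K * (- σ * ι ((p ℕ.+ suc k) C suc b))
    ≡⟨ cong (λ x → K * (σ * ι ((p ℕ.+ k) C suc b)) + K * (- σ * x)) pascal-rule ⟩
  K * (σ * ι ((p ℕ.+ k) C suc b)) + K * (- σ * (ι ((p ℕ.+ k) C b) + ι ((p ℕ.+ k) C suc b)))
    ≡⟨ solve 4 (λ K σ x y → K :* (σ :* y) :+ K :* (:- σ :* (x :+ y)) := K :* (:- σ :* x)) refl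
         K σ (ι ((p ℕ.+ k) C b)) (ι ((p ℕ.+ k) C suc b)) ⟩
  K * (- σ * ι ((p ℕ.+ k) C b))
    ≡⟨ cong (λ x → K * (signℚ x * ι ((p ℕ.+ k) C b))) (ℕₚ.+-suc k s) ⟨
  K * (signℚ (k ℕ.+ suc s) * ι ((p ℕ.+ k) C b)) ∎
  where
  open ≡-Reasoning
  σ = signℚ (k ℕ.+ s)
  ih : ∀ k → k ℕ.+ s ≤ a → pascal s h k ≡ K * (signℚ (k ℕ.+ s) * ι ((p ℕ.+ k) C suc b))
  ih = pascal-alternating {a} {p} {K} {h} s (suc b)
    (λ k k≤a → trans (hyp k k≤a) (cong (λ x → K * (signℚ k * ι ((p ℕ.+ k) C x))) (ℕₚ.+-suc b s)))
  pascal-rule : ι ((p ℕ.+ suc k) C suc b) ≡ ι ((p ℕ.+ k) C b) + ι ((p ℕ.+ k) C suc b)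
  pascal-rule = trans (cong (λ x → ι (x C suc b)) (ℕₚ.+-suc p k))
    (trans (cong ι (sym (nCk+nC[k+1]≡[n+1]C[k+1] (p ℕ.+ k) b))) (ι-+ ((p ℕ.+ k) C b) _))

-- After `b` steps only `C(p+k,0) = 1` is left, so the values at 0 and 1 are opposite and the last
-- step cancels them: a polynomial of degree `b` has zero difference of order `b + 1`.
pascal-vanishing : ∀ {b p} {K : ℚ} {h : ℕ → ℚ} →
  (∀ k → k ≤ suc b → h k ≡ K * (signℚ k * ι ((p ℕ.+ k) C b))) → pascal (suc b) h 0 ≡ 0ℚ
pascal-vanishing {b} {p} {K} {h} hyp = begin
  pascal b h 0 + pascal b h 1
    ≡⟨ cong₂ _+_ (pascal-alternating {suc b} {p} {K} {h} b 0 hyp 0 (ℕₚ.n≤1+n b))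
                 (pascal-alternating {suc b} {p} {K} {h} b 0 hyp 1 ℕₚ.≤-refl) ⟩
  K * (σ * ι ((p ℕ.+ 0) C 0)) + K * (- σ * ι ((p ℕ.+ 1) C 0))
    ≡⟨ cong₂ (λ x y → K * (σ * ι x) + K * (- σ * ι y)) (n-C-0 (p ℕ.+ 0)) (n-C-0 (p ℕ.+ 1)) ⟩
  K * (σ * ι 1) + K * (- σ * ι 1)
    ≡⟨ solve 3 (λ K σ x → K :* (σ :* x) :+ K :* (:- σ :* x) := con 0ℚ) refl K σ (ι 1) ⟩
  0ℚ ∎
  where
  open ≡-Reasoning
  σ = signℚ b

-- The entry of M* at |R ∩ C| = r ∸ k, where m = c ∸ r and q = N ∸ c.
entry : ℕ → ℕ → ℕ → ℚ
entry m q k = divℕ (signℚ k * binomℤ (+ (m ℕ.+ k) ℤ.- + 1) k) (((q ℕ.+ m) C m) ℕ.* (q C k))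

-- It is applied to the size of a set difference. For two sets of equal size this gives the
-- Kronecker delta.
δ : ℕ → ℚ
δ zero    = 1ℚ
δ (suc _) = 0ℚ

entry-0 : ∀ m q → ι ((q ℕ.+ m) C q) * entry m q 0 ≡ 1ℚ
entry-0 m q = begin
  ι ((q ℕ.+ m) C q) * divℕ (1ℚ * binomℤ (+ (m ℕ.+ 0) ℤ.- + 1) 0) (((q ℕ.+ m) C m) ℕ.* (q C 0))
    ≡⟨ cong₂ (λ x y → ι x * divℕ 1ℚ y) C-sym
         (trans (cong (((q ℕ.+ m) C m) ℕ.*_) (n-C-0 q)) (ℕₚ.*-identityʳ ((q ℕ.+ m) C m))) ⟩
  ι ((q ℕ.+ m) C m) * divℕ 1ℚ ((q ℕ.+ m) C m)
    ≡⟨ trans (*-comm (ι ((q ℕ.+ m) C m)) _) (divℕ-*ι 1ℚ ((q ℕ.+ m) C m) {{C≢0 q m}}) ⟩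
  1ℚ ∎
  where
  open ≡-Reasoning
  C-sym : (q ℕ.+ m) C q ≡ (q ℕ.+ m) C m
  C-sym = trans (nCk≡nC[n∸k] (ℕₚ.m≤m+n q m)) (cong ((q ℕ.+ m) C_) (ℕₚ.m+n∸m≡n q m))

-- With `m = p + 1` and `a = b + 1`, `C-exchange-total` merges the three binomial coefficients that
-- depend on `k` into `C(p+k,b)`, of degree `b` in `k`; everything else but the sign is constant.
weighted-entry : ∀ {p b q e} → e ℕ.+ b ≡ p ℕ.+ q → ∀ k v → k ℕ.+ v ≡ q →
  ι (e C v) * entry (suc p) q k ≡
  divℕ (ι (e ! ℕ.* b !)) (p ! ℕ.* q ! ℕ.* ((q ℕ.+ suc p) C suc p)) * (signℚ k * ι ((p ℕ.+ k) C b))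
weighted-entry {p} {b} {_} {e} eq k v refl =
  -- Both denominators, that of the entry and that of the constant `K`, are cleared, which leaves an
  -- identity between natural numbers.
  *ι-cancel (M ℕ.* Q) {{MQ≢0}} _ _ (*ι-cancel D {{D≢0}} _ _ (begin
    ι E * divℕ (σ * binomℤ (+ (suc p ℕ.+ k) ℤ.- + 1) k) (M ℕ.* Q) * ι (M ℕ.* Q) * ι D
      ≡⟨ cong (_* ι D) (trans (*-assoc (ι E) _ _) (cong (ι E *_) (divℕ-*ι _ (M ℕ.* Q) {{MQ≢0}}))) ⟩
    ι E * (σ * binomℤ (+ (p ℕ.+ k)) k) * ι D
      ≡⟨ cong (λ x → ι E * (σ * x) * ι D) (binomℤ-C p k) ⟩
    ι E * (σ * ι B) * ι D
      ≡⟨ cong (ι E * (σ * ι B) *_) (ι-* (p ! ℕ.* q !) M) ⟩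
    ι E * (σ * ι B) * (ι (p ! ℕ.* q !) * ι M)
      ≡⟨ solve 5 (λ E σ B P M → E :* (σ :* B) :* (P :* M) := σ :* (E :* B :* P) :* M) refl
           (ι E) σ (ι B) (ι (p ! ℕ.* q !)) (ι M) ⟩
    σ * (ι E * ι B * ι (p ! ℕ.* q !)) * ι M
      ≡⟨ cong (λ x → σ * x * ι M) exchange ⟩
    σ * (ι (e ! ℕ.* b !) * (ι Q * ι X)) * ι M
      ≡⟨ solve 5 (λ σ N Q X M → σ :* (N :* (Q :* X)) :* M := N :* (σ :* X) :* (M :* Q)) refl
           σ (ι (e ! ℕ.* b !)) (ι Q) (ι X) (ι M) ⟩
    ι (e ! ℕ.* b !) * (σ * ι X) * (ι M * ι Q)
      ≡⟨ cong₂ (λ x y → x * (σ * ι X) * y) (divℕ-*ι (ι (e ! ℕ.* b !)) D {{D≢0}}) (ι-* M Q) ⟨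
    K * ι D * (σ * ι X) * ι (M ℕ.* Q)
      ≡⟨ solve 4 (λ K D S T → K :* D :* S :* T := K :* S :* T :* D) refl K (ι D) (σ * ι X) (ι (M ℕ.* Q)) ⟩
    K * (σ * ι X) * ι (M ℕ.* Q) * ι D ∎))
  where
  open ≡-Reasoning
  q = k ℕ.+ v
  σ = signℚ k
  E = e C v
  B = (p ℕ.+ k) C k
  X = (p ℕ.+ k) C b
  M = (q ℕ.+ suc p) C suc p
  Q = q C k
  D = p ! ℕ.* q ! ℕ.* M
  K = divℕ (ι (e ! ℕ.* b !)) D
  Q≢0 : ℕ.NonZero Q
  Q≢0 = subst (λ n → ℕ.NonZero (n C k)) (ℕₚ.+-comm v k) (C≢0 v k)
  MQ≢0 : ℕ.NonZero (M ℕ.* Q)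
  MQ≢0 = ℕₚ.m*n≢0 M Q {{C≢0 q (suc p)}} {{Q≢0}}
  D≢0 : ℕ.NonZero D
  D≢0 = ℕₚ.m*n≢0 _ M {{p ℕₚ.!* q !≢0}} {{C≢0 q (suc p)}}
  exchange : ι E * ι B * ι (p ! ℕ.* q !) ≡ ι (e ! ℕ.* b !) * (ι Q * ι X)
  exchange = begin
    ι E * ι B * ι (p ! ℕ.* q !)              ≡⟨ cong (_* ι (p ! ℕ.* q !)) (ι-* E B) ⟨
    ι (E ℕ.* B) * ι (p ! ℕ.* q !)            ≡⟨ ι-* (E ℕ.* B) (p ! ℕ.* q !) ⟨
    ι (E ℕ.* B ℕ.* (p ! ℕ.* q !))            ≡⟨ cong ι (C-exchange-total b p k e v eq) ⟩
    ι (e ! ℕ.* b ! ℕ.* (Q ℕ.* X))            ≡⟨ ι-* (e ! ℕ.* b !) (Q ℕ.* X) ⟩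
    ι (e ! ℕ.* b !) * ι (Q ℕ.* X)            ≡⟨ cong (ι (e ! ℕ.* b !) *_) (ι-* Q X) ⟩
    ι (e ! ℕ.* b !) * (ι Q * ι X)            ∎

-- With m = 0 the binomial coefficient in the entry is 0 for k > 0, and e C q is 0 as e < q.
weighted-entry-0 : ∀ {b q e} → e ℕ.+ suc b ≡ q → ∀ k v → k ℕ.+ v ≡ q →
  ι (e C v) * entry 0 q k ≡ 0ℚ
weighted-entry-0 {b} {_} {e} eq zero v refl = trans
  (cong (λ x → ι x * entry 0 v 0) (k>n⇒nCk≡0 (subst (e <_) eq (ℕₚ.m<m+n e (s≤s z≤n)))))
  (*-zeroˡ (entry 0 v 0))
weighted-entry-0 {b} {q} {e} eq (suc k) v _ = begin
  ι (e C v) * divℕ (signℚ (suc k) * binomℤ (+ k) (suc k)) d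
    ≡⟨ cong (λ x → ι (e C v) * divℕ (signℚ (suc k) * x) d) (binomℤ-suc≡0 k) ⟩
  ι (e C v) * divℕ (signℚ (suc k) * 0ℚ) d
    ≡⟨ cong (λ x → ι (e C v) * divℕ x d) (*-zeroʳ (signℚ (suc k))) ⟩
  ι (e C v) * divℕ 0ℚ d
    ≡⟨ cong (ι (e C v) *_) (divℕ-0 d) ⟩
  ι (e C v) * 0ℚ
    ≡⟨ *-zeroʳ (ι (e C v)) ⟩
  0ℚ ∎
  where
  open ≡-Reasoning
  d = ((q ℕ.+ 0) C 0) ℕ.* (q C suc k)

-- This is the alternating sum to which both matrix products reduce. For `a = 0` its single term is
-- 1 by the normalisation of the entries; for `a = b + 1` it is a difference of order `b + 1` of a
-- polynomial of degree `b`. The case `m = 0` is separate because `p = m - 1` is needed.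
pascal-entry : ∀ {m q e} a {h : ℕ → ℚ} → a ≤ q → e ℕ.+ a ≡ m ℕ.+ q →
  (∀ k v → k ≤ a → k ℕ.+ v ≡ q → h k ≡ ι (e C v) * entry m q k) → pascal a h 0 ≡ δ a
pascal-entry {m} {q} {e} zero {h} _ eq hyp = begin
  h 0                             ≡⟨ hyp 0 q z≤n refl ⟩
  ι (e C q) * entry m q 0         ≡⟨ cong (λ x → ι (x C q) * entry m q 0) e≡ ⟩
  ι ((q ℕ.+ m) C q) * entry m q 0 ≡⟨ entry-0 m q ⟩
  1ℚ                              ∎
  where
  open ≡-Reasoning
  e≡ : e ≡ q ℕ.+ m
  e≡ = trans (sym (ℕₚ.+-identityʳ e)) (trans eq (ℕₚ.+-comm m q))
-- All relevant values of `h` are zero, hence the constant `0ℚ`; the choice `p = 0` is arbitrary.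
pascal-entry {zero} {q} {e} (suc b) {h} a≤q eq hyp = pascal-vanishing {b} {0} {0ℚ} {h} λ k k≤a →
  let k+v = ℕₚ.m+[n∸m]≡n (ℕₚ.≤-trans k≤a a≤q) in
  trans (hyp k (q ∸ k) k≤a k+v)
        (trans (weighted-entry-0 {b} eq k (q ∸ k) k+v) (sym (*-zeroˡ (signℚ k * ι (k C b)))))
pascal-entry {suc p} {q} {e} (suc b) {h} a≤q eq hyp =
  pascal-vanishing {b} {p} {divℕ (ι (e ! ℕ.* b !)) (p ! ℕ.* q ! ℕ.* ((q ℕ.+ suc p) C suc p))} {h} λ k k≤a →
  let k+v = ℕₚ.m+[n∸m]≡n (ℕₚ.≤-trans k≤a a≤q) in
  trans (hyp k (q ∸ k) k≤a k+v)
        (weighted-entry {p} {b} {q} {e} (ℕₚ.suc-injective (trans (sym (ℕₚ.+-suc e b)) eq)) k (q ∸ k) k+v)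

-- Iverson brackets

infixr 8 _⊳_
_⊳_ : Bool → ℚ → ℚ
b ⊳ p = if b then p else 0ℚ

⊳-0 : ∀ b → b ⊳ 0ℚ ≡ 0ℚ
⊳-0 true  = refl
⊳-0 false = refl

⊳-+ : ∀ b p q → b ⊳ (p + q) ≡ b ⊳ p + b ⊳ q
⊳-+ true  p q = refl
⊳-+ false p q = refl

⊳-⊳ : ∀ a b p → a ⊳ b ⊳ p ≡ b ⊳ a ⊳ p
⊳-⊳ true  b p = refl
⊳-⊳ false b p = sym (⊳-0 b)

⊳-∧ : ∀ a b p → (a ∧ b) ⊳ p ≡ b ⊳ a ⊳ p
⊳-∧ true  b p = refl
⊳-∧ false b p = sym (⊳-0 b)

⊳-*ˡ : ∀ b p q → (b ⊳ p) * q ≡ b ⊳ (p * q)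
⊳-*ˡ true  p q = refl
⊳-*ˡ false p q = *-zeroˡ q

⊳-*ʳ : ∀ b p q → p * b ⊳ q ≡ b ⊳ (p * q)
⊳-*ʳ true  p q = refl
⊳-*ʳ false p q = *-zeroʳ p

-- Sums over all subsets

sumOver : {A : Set} → List A → (A → ℚ) → ℚ
sumOver xs f = foldr (λ x acc → f x + acc) 0ℚ xs

sumOver-cong : ∀ {A : Set} (xs : List A) {f g : A → ℚ} → (∀ x → f x ≡ g x) → sumOver xs f ≡ sumOver xs g
sumOver-cong []       eq = refl
sumOver-cong (x ∷ xs) eq = cong₂ _+_ (eq x) (sumOver-cong xs eq)

sumOver-0 : ∀ {A : Set} (xs : List A) → sumOver xs (λ _ → 0ℚ) ≡ 0ℚ
sumOver-0 []       = refl
sumOver-0 (x ∷ xs) = trans (+-identityˡ _) (sumOver-0 xs)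

sumOver-+ : ∀ {A : Set} (xs : List A) (f g : A → ℚ) →
  sumOver xs (λ x → f x + g x) ≡ sumOver xs f + sumOver xs g
sumOver-+ []       f g = refl
sumOver-+ (x ∷ xs) f g = trans (cong (_+_ (f x + g x)) (sumOver-+ xs f g))
  (solve 4 (λ a b c d → a :+ b :+ (c :+ d) := a :+ c :+ (b :+ d)) refl (f x) (g x) (sumOver xs f) (sumOver xs g))

sumOver-*ˡ : ∀ {A : Set} (xs : List A) q (f : A → ℚ) → sumOver xs (λ x → q * f x) ≡ q * sumOver xs f
sumOver-*ˡ []       q f = sym (*-zeroʳ q)
sumOver-*ˡ (x ∷ xs) q f = trans (cong (_+_ (q * f x)) (sumOver-*ˡ xs q f)) (sym (*-distribˡ-+ q (f x) (sumOver xs f)))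

sumOver-*ʳ : ∀ {A : Set} (xs : List A) q (f : A → ℚ) → sumOver xs (λ x → f x * q) ≡ sumOver xs f * q
sumOver-*ʳ xs q f = trans (sumOver-cong xs (λ x → *-comm (f x) q)) (trans (sumOver-*ˡ xs q f) (*-comm q (sumOver xs f)))

sumOver-swap : ∀ {A B : Set} (xs : List A) (ys : List B) (f : A → B → ℚ) →
  sumOver xs (λ x → sumOver ys (f x)) ≡ sumOver ys (λ y → sumOver xs (λ x → f x y))
sumOver-swap []       ys f = sym (sumOver-0 ys)
sumOver-swap (x ∷ xs) ys f = trans (cong (_+_ (sumOver ys (f x))) (sumOver-swap xs ys f))
  (sym (sumOver-+ ys (f x) (λ y → sumOver xs (λ x → f x y))))

sumOver-++ : ∀ {A : Set} (xs ys : List A) (f : A → ℚ) → sumOver (xs ++ ys) f ≡ sumOver xs f + sumOver ys f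
sumOver-++ []       ys f = sym (+-identityˡ _)
sumOver-++ (x ∷ xs) ys f = trans (cong (_+_ (f x)) (sumOver-++ xs ys f)) (sym (+-assoc (f x) _ _))

∑ : ∀ {n} → (Subset n → ℚ) → ℚ
∑ {n} = sumOver (allSubsets n)

∑-cong : ∀ {n} {f g : Subset n → ℚ} → (∀ Z → f Z ≡ g Z) → ∑ f ≡ ∑ g
∑-cong {n} = sumOver-cong (allSubsets n)

∑-suc : ∀ {n} (f : Subset (suc n) → ℚ) → ∑ f ≡ ∑ (λ Z → f (outside ∷ Z)) + ∑ (λ Z → f (inside ∷ Z))
∑-suc {n} f = trans (sumOver-++ (map (outside ∷_) (allSubsets n)) _ f)
  (cong₂ _+_ (foldr-map _ (outside ∷_) 0ℚ (allSubsets n)) (foldr-map _ (inside ∷_) 0ℚ (allSubsets n)))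

∑-delta : ∀ {n} (X : Subset n) (f : Subset n → ℚ) → (∀ Z → Z ≢ X → f Z ≡ 0ℚ) → ∑ f ≡ f X
∑-delta []            f f0 = +-identityʳ (f [])
∑-delta {suc n} (outside ∷ X) f f0 = begin
  ∑ f                                                      ≡⟨ ∑-suc f ⟩
  ∑ (λ Z → f (outside ∷ Z)) + ∑ (λ Z → f (inside ∷ Z))     ≡⟨ cong₂ _+_ (∑-delta X _ (λ Z Z≢X → f0 _ (λ { refl → Z≢X refl })))
                                                                        (∑-cong (λ Z → f0 (inside ∷ Z) (λ ()))) ⟩
  f (outside ∷ X) + ∑ {n} (λ _ → 0ℚ)                       ≡⟨ cong (_+_ (f (outside ∷ X))) (sumOver-0 (allSubsets n)) ⟩
  f (outside ∷ X) + 0ℚ                                     ≡⟨ +-identityʳ _ ⟩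
  f (outside ∷ X)                                          ∎
  where open ≡-Reasoning
∑-delta {suc n} (inside ∷ X) f f0 = begin
  ∑ f                                                      ≡⟨ ∑-suc f ⟩
  ∑ (λ Z → f (outside ∷ Z)) + ∑ (λ Z → f (inside ∷ Z))     ≡⟨ cong₂ _+_ (∑-cong (λ Z → f0 (outside ∷ Z) (λ ())))
                                                                        (∑-delta X _ (λ Z Z≢X → f0 _ (λ { refl → Z≢X refl }))) ⟩
  ∑ {n} (λ _ → 0ℚ) + f (inside ∷ X)                        ≡⟨ cong (_+ f (inside ∷ X)) (sumOver-0 (allSubsets n)) ⟩
  0ℚ + f (inside ∷ X)                                      ≡⟨ +-identityˡ _ ⟩
  f (inside ∷ X)                                           ∎
  where open ≡-Reasoning

-- Sums over subsets of fixed size and matrix products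

≡ᵇ-refl : ∀ n → (n ≡ᵇ n) ≡ true
≡ᵇ-refl zero    = refl
≡ᵇ-refl (suc n) = ≡ᵇ-refl n

≢⇒≡ᵇ-false : ∀ {m n} → m ≢ n → (m ≡ᵇ n) ≡ false
≢⇒≡ᵇ-false {zero}  {zero}  m≢n = ⊥-elim (m≢n refl)
≢⇒≡ᵇ-false {zero}  {suc n} m≢n = refl
≢⇒≡ᵇ-false {suc m} {zero}  m≢n = refl
≢⇒≡ᵇ-false {suc m} {suc n} m≢n = ≢⇒≡ᵇ-false (λ eq → m≢n (cong suc eq))

-- The form is such that `sumSized n k f` unfolds to `∑ (sized k f)`.
sized : ∀ {n} → ℕ → (Subset n → ℚ) → Subset n → ℚ
sized k f Z = (∣ Z ∣ ≡ᵇ k) ⊳ f Z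

sumSized-cong : ∀ {n k} {f g : Subset n → ℚ} → (∀ Z → ∣ Z ∣ ≡ k → f Z ≡ g Z) → sumSized n k f ≡ sumSized n k g
sumSized-cong {n} {k} {f} {g} eq = ∑-cong pointwise
  where
  pointwise : ∀ Z → sized k f Z ≡ sized k g Z
  pointwise Z with ∣ Z ∣ ℕ.≟ k
  ... | yes p = cong ((∣ Z ∣ ≡ᵇ k) ⊳_) (eq Z p)
  ... | no ¬p rewrite ≢⇒≡ᵇ-false ¬p = refl

sumSized-delta : ∀ {n} (X : Subset n) (f : Subset n → ℚ) →
  (∀ Z → ∣ Z ∣ ≡ ∣ X ∣ → Z ≢ X → f Z ≡ 0ℚ) → sumSized n ∣ X ∣ f ≡ f X
sumSized-delta {n} X f f0 = trans (∑-delta X (sized ∣ X ∣ f) vanish)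
  (cong (_⊳ f X) (≡ᵇ-refl ∣ X ∣))
  where
  vanish : ∀ Z → Z ≢ X → sized ∣ X ∣ f Z ≡ 0ℚ
  vanish Z Z≢X with ∣ Z ∣ ℕ.≟ ∣ X ∣
  ... | yes p = trans (cong ((∣ Z ∣ ≡ᵇ ∣ X ∣) ⊳_) (f0 Z p Z≢X)) (⊳-0 (∣ Z ∣ ≡ᵇ ∣ X ∣))
  ... | no ¬p rewrite ≢⇒≡ᵇ-false ¬p = refl

-- Both sides are one double sum over `Z` and `W`, with the size conditions as brackets. `inner` and
-- `outer` take the outer bracket as a Boolean `β`, which allows a case distinction on it.
mul-assoc : ∀ {n} a b (A B D : Mat n) X Y → mul n a (mul n b A B) D X Y ≡ mul n b A (mul n a B D) X Y
mul-assoc {n} a b A B D X Y = begin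
  ∑ (sized a (λ Z → ∑ (sized b (λ W → A X W * B W Z)) * D Z Y))
    ≡⟨ ∑-cong (λ Z → inner (∣ Z ∣ ≡ᵇ a) Z) ⟩
  ∑ (λ Z → ∑ (λ W → term Z W))
    ≡⟨ sumOver-swap (allSubsets n) (allSubsets n) term ⟩
  ∑ (λ W → ∑ (λ Z → term Z W))
    ≡⟨ ∑-cong (λ W → outer (∣ W ∣ ≡ᵇ b) W) ⟨
  ∑ (sized b (λ W → A X W * ∑ (sized a (λ Z → B W Z * D Z Y)))) ∎
  where
  open ≡-Reasoning
  term : Subset n → Subset n → ℚ
  term Z W = (∣ Z ∣ ≡ᵇ a) ⊳ (∣ W ∣ ≡ᵇ b) ⊳ (A X W * B W Z * D Z Y)
  inner : ∀ β Z → β ⊳ (∑ (sized b (λ W → A X W * B W Z)) * D Z Y) ≡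
                  ∑ (λ W → β ⊳ (∣ W ∣ ≡ᵇ b) ⊳ (A X W * B W Z * D Z Y))
  inner false Z = sym (sumOver-0 (allSubsets n))
  inner true  Z = trans (sym (sumOver-*ʳ (allSubsets n) (D Z Y) (sized b (λ W → A X W * B W Z))))
    (∑-cong (λ W → ⊳-*ˡ (∣ W ∣ ≡ᵇ b) (A X W * B W Z) (D Z Y)))
  outer : ∀ β W → β ⊳ (A X W * ∑ (sized a (λ Z → B W Z * D Z Y))) ≡
                  ∑ (λ Z → (∣ Z ∣ ≡ᵇ a) ⊳ β ⊳ (A X W * B W Z * D Z Y))
  outer false W = sym (trans (∑-cong {n} (λ Z → ⊳-0 (∣ Z ∣ ≡ᵇ a))) (sumOver-0 (allSubsets n)))
  outer true  W = trans (sym (sumOver-*ˡ (allSubsets n) (A X W) (sized a (λ Z → B W Z * D Z Y))))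
    (∑-cong (λ Z → trans (⊳-*ʳ (∣ Z ∣ ≡ᵇ a) (A X W) (B W Z * D Z Y))
                         (cong ((∣ Z ∣ ≡ᵇ a) ⊳_) (sym (*-assoc (A X W) (B W Z) (D Z Y))))))

-- Sums over subsets Z of functions of ∣ Z ∣ and ∣ Y ∩ Z ∣

Weight : Set
Weight = ℕ → ℕ → ℚ

-- The new value of `∣ Y ∩ Z ∣` when `k` elements enter `Z`, all in `Y` or all outside `Y` according
-- to `y`.
advance : Bool → ℕ → ℕ → ℕ
advance y k i = if y then k ℕ.+ i else i

-- Summing out one element of the ground set: α and β tell whether Z may omit or contain it,
-- and y whether it belongs to Y.
op : (α β y : Bool) → Weight → Weight
op α β y G z i = α ⊳ G z i + β ⊳ G (suc z) (advance y 1 i)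

op^ : (α β y : Bool) → ℕ → Weight → Weight
op^ α β y zero    G = G
op^ α β y (suc k) G = op α β y (op^ α β y k G)

_≈_ : Weight → Weight → Set
G ≈ H = ∀ z i → G z i ≡ H z i

op-cong : ∀ α β y {G H} → G ≈ H → op α β y G ≈ op α β y H
op-cong α β y eq z i = cong₂ (λ u v → α ⊳ u + β ⊳ v) (eq z i) (eq _ _)

op^-cong : ∀ α β y k {G H} → G ≈ H → op^ α β y k G ≈ op^ α β y k H
op^-cong α β y zero    eq = eq
op^-cong α β y (suc k) eq = op-cong α β y (op^-cong α β y k eq)

advance-comm : ∀ x y i → advance x 1 (advance y 1 i) ≡ advance y 1 (advance x 1 i)
advance-comm true  true  i = refl
advance-comm true  false i = refl
advance-comm false true  i = refl
advance-comm false false i = refl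

-- Elements of the ground set can be summed out in any order; this is why only the sizes of the Venn
-- regions matter.
op-comm : ∀ α β x γ ε y G → op α β x (op γ ε y G) ≈ op γ ε y (op α β x G)
op-comm α β x γ ε y G z i = begin
  α ⊳ (γ ⊳ g₀₀ + ε ⊳ g₀₁) + β ⊳ (γ ⊳ g₁₀ + ε ⊳ g₁₁)
    ≡⟨ cong₂ _+_ (⊳-+ α _ _) (⊳-+ β _ _) ⟩
  (α ⊳ (γ ⊳ g₀₀) + α ⊳ (ε ⊳ g₀₁)) + (β ⊳ (γ ⊳ g₁₀) + β ⊳ (ε ⊳ g₁₁))
    ≡⟨ solve 4 (λ a b c d → a :+ b :+ (c :+ d) := a :+ c :+ (b :+ d)) refl
         (α ⊳ (γ ⊳ g₀₀)) (α ⊳ (ε ⊳ g₀₁)) (β ⊳ (γ ⊳ g₁₀)) (β ⊳ (ε ⊳ g₁₁)) ⟩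
  (α ⊳ (γ ⊳ g₀₀) + β ⊳ (γ ⊳ g₁₀)) + (α ⊳ (ε ⊳ g₀₁) + β ⊳ (ε ⊳ g₁₁))
    ≡⟨ cong₂ _+_ (cong₂ _+_ (⊳-⊳ α γ g₀₀) (⊳-⊳ β γ g₁₀))
                 (cong₂ _+_ (⊳-⊳ α ε g₀₁) (trans (⊳-⊳ β ε g₁₁)
                    (cong (λ j → ε ⊳ (β ⊳ (G (suc (suc z)) j))) (advance-comm y x i)))) ⟩
  (γ ⊳ (α ⊳ g₀₀) + γ ⊳ (β ⊳ g₁₀)) + (ε ⊳ (α ⊳ g₀₁) + ε ⊳ (β ⊳ g₁₁′))
    ≡⟨ cong₂ _+_ (⊳-+ γ _ _) (⊳-+ ε _ _) ⟨
  γ ⊳ (α ⊳ g₀₀ + β ⊳ g₁₀) + ε ⊳ (α ⊳ g₀₁ + β ⊳ g₁₁′) ∎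
  where
  open ≡-Reasoning
  g₀₀  = G z i
  g₀₁  = G (suc z) (advance y 1 i)
  g₁₀  = G (suc z) (advance x 1 i)
  g₁₁  = G (suc (suc z)) (advance y 1 (advance x 1 i))
  g₁₁′ = G (suc (suc z)) (advance x 1 (advance y 1 i))

op^-op : ∀ α β x k γ ε y G → op^ α β x k (op γ ε y G) ≈ op γ ε y (op^ α β x k G)
op^-op α β x zero    γ ε y G z i = refl
op^-op α β x (suc k) γ ε y G z i = trans (op-cong α β x (op^-op α β x k γ ε y G) z i)
  (op-comm α β x γ ε y (op^ α β x k G) z i)

module _ (w : Bool → Bool → Bool) where

  -- The condition on `Z` is elementwise: `w x z` tells whether an element with membership `x` in
  -- `X` may have membership `z` in `Z`.
  admissible : ∀ {n} → Subset n → Subset n → Bool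
  admissible []      []      = true
  admissible (x ∷ X) (z ∷ Z) = w x z ∧ admissible X Z

  ops : (x y : Bool) → ℕ → Weight → Weight
  ops x y = op^ (w x false) (w x true) y

  -- The sizes are those of `X ∖ Y`, `Y ∖ X`, `X ∩ Y` and the complement of the union. The last two
  -- regions stand innermost: they collapse to a shift or a single binomial coefficient before the
  -- differences are summed out.
  vennSum : (a b d e : ℕ) → Weight → Weight
  vennSum a b d e G = ops false true b (ops true false a (ops false false e (ops true true d G)))

  ∑-ops : ∀ {n} x y (X Y : Subset n) G →
    ∑ (λ Z → admissible (x ∷ X) Z ⊳ G ∣ Z ∣ ∣ (y ∷ Y) ∩ Z ∣) ≡
    ∑ (λ Z → admissible X Z ⊳ ops x y 1 G ∣ Z ∣ ∣ Y ∩ Z ∣)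
  ∑-ops {n} x y X Y G = begin
    ∑ f
      ≡⟨ ∑-suc f ⟩
    ∑ (λ Z → f (outside ∷ Z)) + ∑ (λ Z → f (inside ∷ Z))
      ≡⟨ sumOver-+ (allSubsets n) (λ Z → f (outside ∷ Z)) (λ Z → f (inside ∷ Z)) ⟨
    ∑ (λ Z → f (outside ∷ Z) + f (inside ∷ Z))
      ≡⟨ ∑-cong (λ Z → trans (cong₂ _+_ (out y Z) (inn y Z)) (sym (⊳-+ (admissible X Z) _ _))) ⟩
    ∑ (λ Z → admissible X Z ⊳ ops x y 1 G ∣ Z ∣ ∣ Y ∩ Z ∣) ∎
    where
    open ≡-Reasoning
    f : Subset (suc n) → ℚ
    f Z = admissible (x ∷ X) Z ⊳ G ∣ Z ∣ ∣ (y ∷ Y) ∩ Z ∣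
    out : ∀ y Z → (w x false ∧ admissible X Z) ⊳ (G ∣ Z ∣ ∣ (y ∷ Y) ∩ (outside ∷ Z) ∣) ≡
                  admissible X Z ⊳ w x false ⊳ (G ∣ Z ∣ ∣ Y ∩ Z ∣)
    out true  Z = ⊳-∧ (w x false) (admissible X Z) _
    out false Z = ⊳-∧ (w x false) (admissible X Z) _
    inn : ∀ y Z → (w x true ∧ admissible X Z) ⊳ (G (suc ∣ Z ∣) ∣ (y ∷ Y) ∩ (inside ∷ Z) ∣) ≡
                  admissible X Z ⊳ w x true ⊳ (G (suc ∣ Z ∣) (advance y 1 ∣ Y ∩ Z ∣))
    inn true  Z = ⊳-∧ (w x true) (admissible X Z) _
    inn false Z = ⊳-∧ (w x true) (admissible X Z) _

  -- Induction on the ground set: each element contributes one operator, determined by its Venn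
  -- region, and commutation gathers the operators of each region.
  ∑-venn : ∀ {n} (X Y : Subset n) G →
    ∑ (λ Z → admissible X Z ⊳ G ∣ Z ∣ ∣ Y ∩ Z ∣) ≡
    vennSum (∣ X ∩ ∁ Y ∣) (∣ ∁ X ∩ Y ∣) (∣ X ∩ Y ∣) (∣ ∁ X ∩ ∁ Y ∣) G 0 0
  ∑-venn []      []      G = +-identityʳ (G 0 0)
  ∑-venn (x ∷ X) (y ∷ Y) G = trans (∑-ops x y X Y G) (trans (∑-venn X Y (ops x y 1 G)) (absorb x y))
    where
    a = ∣ X ∩ ∁ Y ∣
    b = ∣ ∁ X ∩ Y ∣
    d = ∣ X ∩ Y ∣
    e = ∣ ∁ X ∩ ∁ Y ∣
    push : ∀ x y x′ y′ k {H H′} → H ≈ ops x y 1 H′ → ops x′ y′ k H ≈ ops x y 1 (ops x′ y′ k H′)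
    push x y x′ y′ k {H} {H′} eq z i = trans
      (op^-cong (w x′ false) (w x′ true) y′ k eq z i)
      (op^-op (w x′ false) (w x′ true) y′ k (w x false) (w x true) y H′ z i)
    under : ∀ x y k {H H′} → H ≈ H′ → ops x y k H ≈ ops x y k H′
    under x y = op^-cong (w x false) (w x true) y
    -- The new operator stands innermost. It moves outwards past the groups of other regions to the
    -- front of its own group, whose exponent grows by one.
    absorb : ∀ x y → vennSum a b d e (ops x y 1 G) 0 0 ≡
      vennSum (∣ (x ∷ X) ∩ ∁ (y ∷ Y) ∣) (∣ ∁ (x ∷ X) ∩ (y ∷ Y) ∣)
              (∣ (x ∷ X) ∩ (y ∷ Y) ∣) (∣ ∁ (x ∷ X) ∩ ∁ (y ∷ Y) ∣) G 0 0
    absorb true true =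
      under false true b (under true false a (under false false e
        (push true true true true d (λ _ _ → refl)))) 0 0
    absorb false false =
      under false true b (under true false a
        (push false false false false e (push false false true true d (λ _ _ → refl)))) 0 0
    absorb true false =
      under false true b (push true false true false a
        (push true false false false e (push true false true true d (λ _ _ → refl)))) 0 0
    absorb false true =
      push false true false true b (push false true true false a
        (push false true false false e (push false true true true d (λ _ _ → refl)))) 0 0

-- Evaluation of the operators

advance-suc : ∀ y k i → advance y k (advance y 1 i) ≡ advance y (suc k) i
advance-suc true  k i = ℕₚ.+-suc k i
advance-suc false k i = refl

op^-contain : ∀ y k G → op^ false true y k G ≈ λ z i → G (k ℕ.+ z) (advance y k i)
op^-contain true  zero    G z i = refl
op^-contain false zero    G z i = refl
op^-contain y     (suc k) G z i = trans (+-identityˡ _) (trans (op^-contain y k G (suc z) (advance y 1 i))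
  (cong₂ G (ℕₚ.+-suc k z) (advance-suc y k i)))

op^-omit : ∀ y k G → op^ true false y k G ≈ G
op^-omit y zero    G z i = refl
op^-omit y (suc k) G z i = trans (+-identityʳ _) (op^-omit y k G z i)

-- When all `a` elements may be chosen freely, only the number chosen matters, with binomial
-- multiplicity. A general starting count `j` is needed for the second summand in the induction.
op^-free : ∀ y a G z i j →
  op^ true true y a G (j ℕ.+ z) (advance y j i) ≡ pascal a (λ j → G (j ℕ.+ z) (advance y j i)) j
op^-free y zero    G z i j = refl
op^-free y (suc a) G z i j = cong₂ _+_ (op^-free y a G z i j)
  (trans (cong (op^ true true y a G (suc (j ℕ.+ z))) (advance-1 y)) (op^-free y a G z i (suc j)))
  where
  advance-1 : ∀ y → advance y 1 (advance y j i) ≡ advance y (suc j) i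
  advance-1 true  = refl
  advance-1 false = refl

module _ {k : ℕ} {G : Weight} {F : ℕ → ℚ} (y : Bool)
         (at : ∀ i → G k i ≡ F i) (off : ∀ z i → z ≢ k → G z i ≡ 0ℚ) where

  op^-concentrated-above : ∀ e z i → k < z → op^ true true y e G z i ≡ 0ℚ
  op^-concentrated-above zero    z i k<z = off z i (ℕₚ.>⇒≢ k<z)
  op^-concentrated-above (suc e) z i k<z =
    cong₂ _+_ (op^-concentrated-above e z i k<z) (op^-concentrated-above e (suc z) _ (ℕₚ.m<n⇒m<1+n k<z))

  -- Only choices of exactly `l` of the `e` elements bring the size to `k`, and there are `e C l` of
  -- them; the induction step is Pascal's rule. Sizes never decrease, so a choice that has passed
  -- `k` contributes nothing.
  op^-concentrated : ∀ e l z i → z ℕ.+ l ≡ k → op^ true true y e G z i ≡ ι (e C l) * F (advance y l i)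
  op^-concentrated zero zero z i eq = trans (cong (λ z → G z i) (trans (sym (ℕₚ.+-identityʳ z)) eq))
    (trans (at i) (trans (cong F (advance-0 y)) (sym (*-identityˡ _))))
    where
    advance-0 : ∀ y → i ≡ advance y 0 i
    advance-0 true  = refl
    advance-0 false = refl
  op^-concentrated zero (suc l) z i eq = trans
    (off z i (ℕₚ.<⇒≢ (subst (z <_) eq (ℕₚ.m<m+n z (s≤s z≤n))))) (sym (*-zeroˡ (F (advance y (suc l) i))))
  op^-concentrated (suc e) zero z i eq = trans
    (cong₂ _+_ (op^-concentrated e zero z i eq)
               (op^-concentrated-above e (suc z) _ (subst (_< suc z) (trans (sym (ℕₚ.+-identityʳ z)) eq) ℕₚ.≤-refl)))
    (trans (+-identityʳ _) (cong (λ x → ι x * F (advance y 0 i)) (n-C-0 e)))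
  op^-concentrated (suc e) (suc l) z i eq = begin
    op^ true true y e G z i + op^ true true y e G (suc z) (advance y 1 i)
      ≡⟨ cong₂ _+_ (op^-concentrated e (suc l) z i eq)
                   (op^-concentrated e l (suc z) (advance y 1 i) (trans (sym (ℕₚ.+-suc z l)) eq)) ⟩
    ι (e C suc l) * F (advance y (suc l) i) + ι (e C l) * F (advance y l (advance y 1 i))
      ≡⟨ cong (λ x → ι (e C suc l) * F (advance y (suc l) i) + ι (e C l) * F x) (advance-suc y l i) ⟩
    ι (e C suc l) * F (advance y (suc l) i) + ι (e C l) * F (advance y (suc l) i)
      ≡⟨ *-distribʳ-+ (F (advance y (suc l) i)) (ι (e C suc l)) (ι (e C l)) ⟨
    (ι (e C suc l) + ι (e C l)) * F (advance y (suc l) i)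
      ≡⟨ cong (_* F (advance y (suc l) i)) (trans (+-comm (ι (e C suc l)) (ι (e C l)))
           (trans (sym (ι-+ (e C l) (e C suc l))) (cong ι (nCk+nC[k+1]≡[n+1]C[k+1] e l)))) ⟩
    ι (suc e C suc l) * F (advance y (suc l) i) ∎
    where open ≡-Reasoning

-- Venn diagrams of two subsets

∣p∩q∣+∣p∩∁q∣ : ∀ {n} (p q : Subset n) → ∣ p ∩ q ∣ ℕ.+ ∣ p ∩ ∁ q ∣ ≡ ∣ p ∣
∣p∩q∣+∣p∩∁q∣ []            []            = refl
∣p∩q∣+∣p∩∁q∣ (outside ∷ p) (_ ∷ q)       = ∣p∩q∣+∣p∩∁q∣ p q
∣p∩q∣+∣p∩∁q∣ (inside  ∷ p) (inside  ∷ q) = cong suc (∣p∩q∣+∣p∩∁q∣ p q)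
∣p∩q∣+∣p∩∁q∣ (inside  ∷ p) (outside ∷ q) = trans (ℕₚ.+-suc _ _) (cong suc (∣p∩q∣+∣p∩∁q∣ p q))

∣p∩q∣+∣∁p∩q∣ : ∀ {n} (p q : Subset n) → ∣ p ∩ q ∣ ℕ.+ ∣ ∁ p ∩ q ∣ ≡ ∣ q ∣
∣p∩q∣+∣∁p∩q∣ p q = trans (cong₂ (λ s t → ∣ s ∣ ℕ.+ ∣ t ∣) (∩-comm p q) (∩-comm (∁ p) q)) (∣p∩q∣+∣p∩∁q∣ q p)

∣p∣+∣∁p∣≡n : ∀ {n} (p : Subset n) → ∣ p ∣ ℕ.+ ∣ ∁ p ∣ ≡ n
∣p∣+∣∁p∣≡n []            = refl
∣p∣+∣∁p∣≡n (inside  ∷ p) = cong suc (∣p∣+∣∁p∣≡n p)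
∣p∣+∣∁p∣≡n (outside ∷ p) = trans (ℕₚ.+-suc _ _) (cong suc (∣p∣+∣∁p∣≡n p))

∣p∩∁q∣≡∣∁p∩q∣ : ∀ {n} (p q : Subset n) → ∣ p ∣ ≡ ∣ q ∣ → ∣ p ∩ ∁ q ∣ ≡ ∣ ∁ p ∩ q ∣
∣p∩∁q∣≡∣∁p∩q∣ p q eq = ℕₚ.+-cancelˡ-≡ ∣ p ∩ q ∣ _ _
  (trans (∣p∩q∣+∣p∩∁q∣ p q) (trans eq (sym (∣p∩q∣+∣∁p∩q∣ p q))))

∣∁p∩p∣≡0 : ∀ {n} (p : Subset n) → ∣ ∁ p ∩ p ∣ ≡ 0
∣∁p∩p∣≡0 []            = refl
∣∁p∩p∣≡0 (inside  ∷ p) = ∣∁p∩p∣≡0 p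
∣∁p∩p∣≡0 (outside ∷ p) = ∣∁p∩p∣≡0 p

differences-empty⇒≡ : ∀ {n} (p q : Subset n) → ∣ p ∩ ∁ q ∣ ≡ 0 → ∣ ∁ p ∩ q ∣ ≡ 0 → p ≡ q
differences-empty⇒≡ []            []            _ _ = refl
differences-empty⇒≡ (inside  ∷ p) (inside  ∷ q) s t = cong (inside ∷_) (differences-empty⇒≡ p q s t)
differences-empty⇒≡ (outside ∷ p) (outside ∷ q) s t = cong (outside ∷_) (differences-empty⇒≡ p q s t)
differences-empty⇒≡ (inside  ∷ p) (outside ∷ q) () _
differences-empty⇒≡ (outside ∷ p) (inside  ∷ q) _ ()

δ-off-diagonal : ∀ {n} (p q : Subset n) → ∣ p ∣ ≡ ∣ q ∣ → p ≢ q → δ (∣ ∁ p ∩ q ∣) ≡ 0ℚ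
δ-off-diagonal p q eq p≢q = δ-≢0 (λ t → p≢q (differences-empty⇒≡ p q (trans (∣p∩∁q∣≡∣∁p∩q∣ p q eq) t) t))
  where
  δ-≢0 : ∀ {k} → k ≢ 0 → δ k ≡ 0ℚ
  δ-≢0 {zero}  k≢0 = ⊥-elim (k≢0 refl)
  δ-≢0 {suc k} k≢0 = refl

-- Exchanging `X` and `Y` only exchanges the regions `X ∖ Y` and `Y ∖ X`, and these have the same
-- size when `X` and `Y` do.
∑-symmetric : ∀ w {n} (X Y : Subset n) G → ∣ X ∣ ≡ ∣ Y ∣ →
  ∑ (λ Z → admissible w X Z ⊳ G (∣ Z ∣) (∣ Y ∩ Z ∣)) ≡ ∑ (λ Z → admissible w Y Z ⊳ G (∣ Z ∣) (∣ X ∩ Z ∣))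
∑-symmetric w X Y G eq = begin
  ∑ (λ Z → admissible w X Z ⊳ G (∣ Z ∣) (∣ Y ∩ Z ∣))
    ≡⟨ ∑-venn w X Y G ⟩
  vennSum w (∣ X ∩ ∁ Y ∣) (∣ ∁ X ∩ Y ∣) (∣ X ∩ Y ∣) (∣ ∁ X ∩ ∁ Y ∣) G 0 0
    ≡⟨ cong₂ (λ a b → vennSum w a b (∣ X ∩ Y ∣) (∣ ∁ X ∩ ∁ Y ∣) G 0 0)
         (trans (∣p∩∁q∣≡∣∁p∩q∣ X Y eq) (cong ∣_∣ (∩-comm (∁ X) Y)))
         (trans (sym (∣p∩∁q∣≡∣∁p∩q∣ X Y eq)) (cong ∣_∣ (∩-comm X (∁ Y)))) ⟩
  vennSum w (∣ Y ∩ ∁ X ∣) (∣ ∁ Y ∩ X ∣) (∣ X ∩ Y ∣) (∣ ∁ X ∩ ∁ Y ∣) G 0 0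
    ≡⟨ cong₂ (λ d e → vennSum w (∣ Y ∩ ∁ X ∣) (∣ ∁ Y ∩ X ∣) d e G 0 0)
         (cong ∣_∣ (∩-comm X Y)) (cong ∣_∣ (∩-comm (∁ X) (∁ Y))) ⟩
  vennSum w (∣ Y ∩ ∁ X ∣) (∣ ∁ Y ∩ X ∣) (∣ Y ∩ X ∣) (∣ ∁ Y ∩ ∁ X ∣) G 0 0
    ≡⟨ ∑-venn w Y X G ⟨
  ∑ (λ Z → admissible w Y Z ⊳ G (∣ Z ∣) (∣ X ∩ Z ∣)) ∎
  where open ≡-Reasoning

-- The size of the difference replaces a test of equality, since it is what the Venn computation
-- yields; for sets of equal size it is zero exactly when they coincide.
IsIdentity : ∀ {n} → ℕ → Mat n → Set
IsIdentity {n} k I = (X Y : Subset n) → ∣ X ∣ ≡ k → ∣ Y ∣ ≡ k → I X Y ≡ δ (∣ ∁ X ∩ Y ∣)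

mul-identityˡ : ∀ {n k} {I : Mat n} → IsIdentity k I → ∀ B X Y → ∣ X ∣ ≡ k → mul n k I B X Y ≡ B X Y
mul-identityˡ {n} {_} {I} isI B X Y refl = begin
  sumSized n (∣ X ∣) (λ Z → I X Z * B Z Y)         ≡⟨ sumSized-cong (λ Z p → cong (_* B Z Y) (isI X Z refl p)) ⟩
  sumSized n (∣ X ∣) (λ Z → δ (∣ ∁ X ∩ Z ∣) * B Z Y) ≡⟨ sumSized-delta X _ off ⟩
  δ (∣ ∁ X ∩ X ∣) * B X Y                          ≡⟨ cong (λ x → δ x * B X Y) (∣∁p∩p∣≡0 X) ⟩
  1ℚ * B X Y                                     ≡⟨ *-identityˡ (B X Y) ⟩
  B X Y                                          ∎
  where
  open ≡-Reasoning
  off : ∀ Z → ∣ Z ∣ ≡ ∣ X ∣ → Z ≢ X → δ (∣ ∁ X ∩ Z ∣) * B Z Y ≡ 0ℚ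
  off Z p Z≢X = trans (cong (_* B Z Y) (δ-off-diagonal X Z (sym p) (λ eq → Z≢X (sym eq)))) (*-zeroˡ (B Z Y))

mul-identityʳ : ∀ {n k} {I : Mat n} → IsIdentity k I → ∀ B X Y → ∣ Y ∣ ≡ k → mul n k B I X Y ≡ B X Y
mul-identityʳ {n} {_} {I} isI B X Y refl = begin
  sumSized n (∣ Y ∣) (λ Z → B X Z * I Z Y)         ≡⟨ sumSized-cong (λ Z p → cong (B X Z *_) (isI Z Y p refl)) ⟩
  sumSized n (∣ Y ∣) (λ Z → B X Z * δ (∣ ∁ Z ∩ Y ∣)) ≡⟨ sumSized-delta Y _ off ⟩
  B X Y * δ (∣ ∁ Y ∩ Y ∣)                          ≡⟨ cong (λ x → B X Y * δ x) (∣∁p∩p∣≡0 Y) ⟩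
  B X Y * 1ℚ                                     ≡⟨ *-identityʳ (B X Y) ⟩
  B X Y                                          ∎
  where
  open ≡-Reasoning
  off : ∀ Z → ∣ Z ∣ ≡ ∣ Y ∣ → Z ≢ Y → B X Z * δ (∣ ∁ Z ∩ Y ∣) ≡ 0ℚ
  off Z p Z≢Y = trans (cong (B X Z *_) (δ-off-diagonal Z Y p Z≢Y)) (*-zeroʳ (B X Z))

-- The products M M* and M* M

contains contained : Bool → Bool → Bool
contains  x z = not x ∨ z
contained x z = not z ∨ x

⊆?-contains : ∀ {n} (X Z : Subset n) → ⌊ X ⊆? Z ⌋ ≡ admissible contains X Z
⊆?-contains X Z = trans (isYes≗does (X ⊆? Z)) (go X Z)
  where
  go : ∀ {n} (X Z : Subset n) → does (X ⊆? Z) ≡ admissible contains X Z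
  go []            []            = refl
  go (outside ∷ X) (_ ∷ Z)       = go X Z
  go (inside  ∷ X) (outside ∷ Z) = refl
  go (inside  ∷ X) (inside  ∷ Z) = go X Z

⊆?-contained : ∀ {n} (X Z : Subset n) → ⌊ Z ⊆? X ⌋ ≡ admissible contained X Z
⊆?-contained X Z = trans (isYes≗does (Z ⊆? X)) (go X Z)
  where
  go : ∀ {n} (X Z : Subset n) → does (Z ⊆? X) ≡ admissible contained X Z
  go []            []            = refl
  go (_ ∷ X)       (outside ∷ Z) = go X Z
  go (outside ∷ X) (inside  ∷ Z) = refl
  go (inside  ∷ X) (inside  ∷ Z) = go X Z

-- `Mstar` as a function of the intersection size alone, so that its entries can serve as a
-- `Weight`.
MstarEntry : (n r c i : ℕ) → ℚ
MstarEntry n r c i = divℕ (signℚ (r ∸ i) * binomℤ ((+ c) ℤ.- (+ i) ℤ.- (+ 1)) (r ∸ i))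
  (((n ⊔ (r ℕ.+ c) ∸ r) C (c ∸ r)) ℕ.* ((n ⊔ (r ℕ.+ c) ∸ c) C (r ∸ i)))

MstarEntry≡entry : ∀ {n r c m q i k} → n ⊔ (r ℕ.+ c) ≡ q ℕ.+ c → c ≡ m ℕ.+ r → i ℕ.+ k ≡ r →
  MstarEntry n r c i ≡ entry m q k
MstarEntry≡entry {n} {_} {_} {m} {q} {i} {k} N≡ refl refl = begin
  MstarEntry n r c i
    ≡⟨ cong (λ N → divℕ (signℚ (r ∸ i) * binomℤ (+ c ℤ.- + i ℤ.- + 1) (r ∸ i))
                        (((N ∸ r) C (c ∸ r)) ℕ.* ((N ∸ c) C (r ∸ i)))) N≡ ⟩
  divℕ (signℚ (r ∸ i) * binomℤ (+ c ℤ.- + i ℤ.- + 1) (r ∸ i))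
       (((q ℕ.+ c ∸ r) C (c ∸ r)) ℕ.* ((q ℕ.+ c ∸ c) C (r ∸ i)))
    ≡⟨ cong₂ (λ s x → divℕ (signℚ s * binomℤ (x ℤ.- + 1) s) (((q ℕ.+ c ∸ r) C (c ∸ r)) ℕ.* ((q ℕ.+ c ∸ c) C s)))
         (ℕₚ.m+n∸m≡n i k) c-i ⟩
  divℕ (signℚ k * binomℤ (+ (m ℕ.+ k) ℤ.- + 1) k) (((q ℕ.+ c ∸ r) C (c ∸ r)) ℕ.* ((q ℕ.+ c ∸ c) C k))
    ≡⟨ cong₂ (λ s t → divℕ (signℚ k * binomℤ (+ (m ℕ.+ k) ℤ.- + 1) k) ((s C (c ∸ r)) ℕ.* (t C k)))
         (trans (cong (_∸ r) (sym (ℕₚ.+-assoc q m r))) (ℕₚ.m+n∸n≡m (q ℕ.+ m) r)) (ℕₚ.m+n∸n≡m q c) ⟩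
  divℕ (signℚ k * binomℤ (+ (m ℕ.+ k) ℤ.- + 1) k) (((q ℕ.+ m) C (c ∸ r)) ℕ.* (q C k))
    ≡⟨ cong (λ s → divℕ (signℚ k * binomℤ (+ (m ℕ.+ k) ℤ.- + 1) k) (((q ℕ.+ m) C s) ℕ.* (q C k)))
         (ℕₚ.m+n∸n≡m m r) ⟩
  entry m q k ∎
  where
  open ≡-Reasoning
  r = i ℕ.+ k
  c = m ℕ.+ r
  swap : ∀ m i k → m ℕ.+ (i ℕ.+ k) ≡ i ℕ.+ (m ℕ.+ k)
  swap = solve-∀
  c-i : + c ℤ.- + i ≡ + (m ℕ.+ k)
  c-i = begin
    + c ℤ.- + i                  ≡⟨ ℤₚ.[+m]-[+n]≡m⊖n c i ⟩
    c ℤ.⊖ i                      ≡⟨ cong (ℤ._⊖ i) (swap m i k) ⟩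
    (i ℕ.+ (m ℕ.+ k)) ℤ.⊖ i      ≡⟨ ℤₚ.⊖-≥ (ℕₚ.m≤m+n i (m ℕ.+ k)) ⟩
    + (i ℕ.+ (m ℕ.+ k) ∸ i)      ≡⟨ cong +_ (ℕₚ.m+n∸m≡n i (m ℕ.+ k)) ⟩
    + (m ℕ.+ k)                  ∎

module _ (n r c : ℕ) where

  weight : ℕ → Weight
  weight k z i = (z ≡ᵇ k) ⊳ MstarEntry n r c i

  M·M* M*·M : Mat n
  M·M* = mul n c (inclM n r c) (Mstar n r c)
  M*·M = mul n r (Mstar n r c) (inclM n r c)

  M·M*-∑ : ∀ X Y → M·M* X Y ≡ ∑ (λ Z → admissible contains X Z ⊳ weight c (∣ Z ∣) (∣ Y ∩ Z ∣))
  M·M*-∑ X Y = ∑-cong λ Z → let m = MstarEntry n r c (∣ Y ∩ Z ∣) in begin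
    (∣ Z ∣ ≡ᵇ c) ⊳ (⌊ X ⊆? Z ⌋ ⊳ 1ℚ * m)
      ≡⟨ cong (λ x → (∣ Z ∣ ≡ᵇ c) ⊳ (x ⊳ 1ℚ * m)) (⊆?-contains X Z) ⟩
    (∣ Z ∣ ≡ᵇ c) ⊳ (admissible contains X Z ⊳ 1ℚ * m)
      ≡⟨ cong ((∣ Z ∣ ≡ᵇ c) ⊳_) (trans (⊳-*ˡ (admissible contains X Z) 1ℚ m)
           (cong (admissible contains X Z ⊳_) (*-identityˡ m))) ⟩
    (∣ Z ∣ ≡ᵇ c) ⊳ admissible contains X Z ⊳ m
      ≡⟨ ⊳-⊳ (∣ Z ∣ ≡ᵇ c) (admissible contains X Z) m ⟩
    admissible contains X Z ⊳ (∣ Z ∣ ≡ᵇ c) ⊳ m ∎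
    where open ≡-Reasoning

  M*·M-∑ : ∀ X Y → M*·M X Y ≡ ∑ (λ Z → admissible contained Y Z ⊳ weight r (∣ Z ∣) (∣ X ∩ Z ∣))
  M*·M-∑ X Y = ∑-cong λ Z → let m = MstarEntry n r c (∣ X ∩ Z ∣) in begin
    (∣ Z ∣ ≡ᵇ r) ⊳ (MstarEntry n r c (∣ Z ∩ X ∣) * ⌊ Z ⊆? Y ⌋ ⊳ 1ℚ)
      ≡⟨ cong₂ (λ S x → (∣ Z ∣ ≡ᵇ r) ⊳ (MstarEntry n r c (∣ S ∣) * x ⊳ 1ℚ)) (∩-comm Z X) (⊆?-contained Y Z) ⟩
    (∣ Z ∣ ≡ᵇ r) ⊳ (m * admissible contained Y Z ⊳ 1ℚ)
      ≡⟨ cong ((∣ Z ∣ ≡ᵇ r) ⊳_) (trans (⊳-*ʳ (admissible contained Y Z) m 1ℚ)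
           (cong (admissible contained Y Z ⊳_) (*-identityʳ m))) ⟩
    (∣ Z ∣ ≡ᵇ r) ⊳ admissible contained Y Z ⊳ m
      ≡⟨ ⊳-⊳ (∣ Z ∣ ≡ᵇ r) (admissible contained Y Z) m ⟩
    admissible contained Y Z ⊳ (∣ Z ∣ ≡ᵇ r) ⊳ m ∎
    where open ≡-Reasoning

  weight-at : ∀ k i → weight k k i ≡ MstarEntry n r c i
  weight-at k i = cong (_⊳ MstarEntry n r c i) (≡ᵇ-refl k)

  weight-off : ∀ k z i → z ≢ k → weight k z i ≡ 0ℚ
  weight-off k z i z≢k = cong (_⊳ MstarEntry n r c i) (≢⇒≡ᵇ-false z≢k)

  M·M*-symmetric : MatEq n r r (transpose M·M*) M·M*
  M·M*-symmetric X Y p q = trans (M·M*-∑ Y X)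
    (trans (∑-symmetric contains Y X (weight c) (trans q (sym p))) (sym (M·M*-∑ X Y)))

  M*·M-symmetric : MatEq n c c (transpose M*·M) M*·M
  M*·M-symmetric X Y p q = trans (M*·M-∑ Y X)
    (trans (∑-symmetric contained X Y (weight r) (trans p (sym q))) (sym (M*·M-∑ X Y)))

-- The case `n ≥ r + c`

module _ {r m q : ℕ} where

  private
    c = m ℕ.+ r

  -- Since `Z` contains `X`, it is given by `j` elements of `Y ∖ X` and `m - j` of the `e` elements
  -- outside both sets. Then `∣ Y ∩ Z ∣ = d + j`, so the entry has `k = b - j`, and
  -- `C(e,m-j) = C(e,q-k)` by symmetry.
  M·M*-identity : r ≤ q → IsIdentity r (M·M* (q ℕ.+ c) r c)
  M·M*-identity r≤q X Y p p′ = begin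
    M·M* n r c X Y
      ≡⟨ M·M*-∑ n r c X Y ⟩
    ∑ (λ Z → admissible contains X Z ⊳ G (∣ Z ∣) (∣ Y ∩ Z ∣))
      ≡⟨ ∑-venn contains X Y G ⟩
    op^ true true true b H 0 0
      ≡⟨ op^-free true b H 0 0 0 ⟩
    pascal b (λ j → H (j ℕ.+ 0) (j ℕ.+ 0)) 0
      -- The index changes from the number `j` of elements of `Y ∖ X` in `Z` to the number `k` of
      -- those missing from `Z`.
      ≡⟨ pascal-reverse {b} values b 0 0 refl ⟩
    pascal b g 0
      ≡⟨ pascal-entry b b≤q e+b (λ k v _ k+v → cong (λ x → ι (e C x) * entry m q k) (q∸k k v k+v)) ⟩
    δ b ∎
    where
    open ≡-Reasoning
    n = q ℕ.+ c
    G = weight n r c c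
    a = ∣ X ∩ ∁ Y ∣
    b = ∣ ∁ X ∩ Y ∣
    d = ∣ X ∩ Y ∣
    e = ∣ ∁ X ∩ ∁ Y ∣
    G′ = op^ false true true d G
    H = op^ false true false a (op^ true true false e G′)
    g : ℕ → ℚ
    g k = ι (e C (q ∸ k)) * entry m q k
    q∸k : ∀ k v → k ℕ.+ v ≡ q → q ∸ k ≡ v
    q∸k k v eq = trans (cong (_∸ k) (sym eq)) (ℕₚ.m+n∸m≡n k v)
    d+b : d ℕ.+ b ≡ r
    d+b = trans (∣p∩q∣+∣∁p∩q∣ X Y) p′
    d+a : d ℕ.+ a ≡ r
    d+a = trans (∣p∩q∣+∣p∩∁q∣ X Y) p
    b≤q : b ≤ q
    b≤q = ℕₚ.≤-trans (subst (b ≤_) d+b (ℕₚ.m≤n+m b d)) r≤q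
    reorder : ∀ q m r → q ℕ.+ (m ℕ.+ r) ≡ r ℕ.+ (m ℕ.+ q)
    reorder = solve-∀
    e+b : e ℕ.+ b ≡ m ℕ.+ q
    e+b = ℕₚ.+-cancelˡ-≡ r _ _ (begin
      r ℕ.+ (e ℕ.+ b)       ≡⟨ cong (r ℕ.+_) (trans (ℕₚ.+-comm e b) (∣p∩q∣+∣p∩∁q∣ (∁ X) Y)) ⟩
      r ℕ.+ ∣ ∁ X ∣         ≡⟨ cong (ℕ._+ ∣ ∁ X ∣) p ⟨
      ∣ X ∣ ℕ.+ ∣ ∁ X ∣     ≡⟨ ∣p∣+∣∁p∣≡n X ⟩
      q ℕ.+ (m ℕ.+ r)       ≡⟨ reorder q m r ⟩
      r ℕ.+ (m ℕ.+ q)       ∎)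
    N≡ : n ⊔ (r ℕ.+ c) ≡ q ℕ.+ c
    N≡ = ℕₚ.m≥n⇒m⊔n≡m (ℕₚ.+-monoˡ-≤ c r≤q)
    d+[a+m] : d ℕ.+ (a ℕ.+ m) ≡ c
    d+[a+m] = trans (sym (ℕₚ.+-assoc d a m)) (trans (cong (ℕ._+ m) d+a) (ℕₚ.+-comm r m))
    at : ∀ i → G′ (a ℕ.+ m) i ≡ MstarEntry n r c (d ℕ.+ i)
    at i = trans (op^-contain true d G (a ℕ.+ m) i)
      (trans (cong (λ z → G z (d ℕ.+ i)) d+[a+m]) (weight-at n r c c (d ℕ.+ i)))
    off : ∀ z i → z ≢ a ℕ.+ m → G′ z i ≡ 0ℚ
    off z i z≢ = trans (op^-contain true d G z i) (weight-off n r c c (d ℕ.+ z) (d ℕ.+ i)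
      (λ eq → z≢ (ℕₚ.+-cancelˡ-≡ d _ _ (trans eq (sym d+[a+m])))))
    values : ∀ j k → j ℕ.+ k ≡ b → H (j ℕ.+ 0) (j ℕ.+ 0) ≡ g k
    values j k j+k = trans (cong₂ H (ℕₚ.+-identityʳ j) (ℕₚ.+-identityʳ j))
      (trans (op^-contain false a (op^ true true false e G′) j j) (value (j ℕ.≤? m)))
      where
      v = q ∸ k
      k+v : k ℕ.+ v ≡ q
      k+v = ℕₚ.m+[n∸m]≡n (ℕₚ.≤-trans (subst (k ≤_) j+k (ℕₚ.m≤n+m k j)) b≤q)
      reorder₁ : ∀ e j k → e ℕ.+ j ℕ.+ k ≡ e ℕ.+ (j ℕ.+ k)
      reorder₁ = solve-∀
      reorder₂ : ∀ m k v → m ℕ.+ (k ℕ.+ v) ≡ m ℕ.+ v ℕ.+ k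
      reorder₂ = solve-∀
      e+j : e ℕ.+ j ≡ m ℕ.+ v
      e+j = ℕₚ.+-cancelʳ-≡ k _ _ (trans (reorder₁ e j k) (trans (cong (e ℕ.+_) j+k)
        (trans e+b (trans (cong (m ℕ.+_) (sym k+v)) (reorder₂ m k v)))))
      value : Dec (j ≤ m) → op^ true true false e G′ (a ℕ.+ j) j ≡ ι (e C v) * entry m q k
      value (yes j≤m) = begin
        op^ true true false e G′ (a ℕ.+ j) j
          ≡⟨ op^-concentrated false at off e l (a ℕ.+ j) j
               (trans (ℕₚ.+-assoc a j l) (cong (a ℕ.+_) j+l)) ⟩
        ι (e C l) * MstarEntry n r c (d ℕ.+ j)
          ≡⟨ cong₂ (λ x y → ι x * y) C-sym
               (MstarEntry≡entry {n} {r} {c} {m} {q} {d ℕ.+ j} {k} N≡ refl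
                 (trans (ℕₚ.+-assoc d j k) (trans (cong (d ℕ.+_) j+k) d+b))) ⟩
        ι (e C v) * entry m q k ∎
        where
        l = m ∸ j
        j+l : j ℕ.+ l ≡ m
        j+l = ℕₚ.m+[n∸m]≡n j≤m
        reorder₃ : ∀ j l v → j ℕ.+ l ℕ.+ v ≡ l ℕ.+ v ℕ.+ j
        reorder₃ = solve-∀
        e≡l+v : e ≡ l ℕ.+ v
        e≡l+v = ℕₚ.+-cancelʳ-≡ j _ _ (trans e+j (trans (cong (ℕ._+ v) (sym j+l)) (reorder₃ j l v)))
        C-sym : e C l ≡ e C v
        C-sym = trans (nCk≡nC[n∸k] (subst (l ≤_) (sym e≡l+v) (ℕₚ.m≤m+n l v)))
          (cong (e C_) (trans (cong (_∸ l) e≡l+v) (ℕₚ.m+n∸m≡n l v)))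
      -- With more than `m` elements added, `Z` is already too large and the left side is zero; on
      -- the right, `e + j = m + v` gives `e < v`.
      value (no j≰m) = trans
        (op^-concentrated-above false at off e (a ℕ.+ j) j (ℕₚ.+-monoʳ-< a (ℕₚ.≰⇒> j≰m)))
        (sym (trans (cong (λ x → ι x * entry m q k) (k>n⇒nCk≡0 e<v)) (*-zeroˡ (entry m q k))))
        where
        e<v : e < v
        e<v = ℕₚ.+-cancelʳ-< j e v (subst (_< v ℕ.+ j) (trans (ℕₚ.+-comm v m) (sym e+j))
          (ℕₚ.+-monoʳ-< v (ℕₚ.≰⇒> j≰m)))

-- The case `n ≤ r + c`

module _ {n r m : ℕ} where

  private
    c = m ℕ.+ r

  -- Now `N = r + c`, so `q = r`. The column index `X` contains `Z`, which is given by `k` elements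
  -- of `X ∖ Y` and `v = r - k` of the `d` elements of `X ∩ Y`; hence `∣ Y ∩ Z ∣ = v`, with
  -- multiplicity `d C v`.
  M*·M-identity : n ≤ r ℕ.+ c → IsIdentity c (M*·M n r c)
  M*·M-identity n≤r+c Y X p′ p = begin
    M*·M n r c Y X
      ≡⟨ M*·M-∑ n r c Y X ⟩
    ∑ (λ Z → admissible contained X Z ⊳ G (∣ Z ∣) (∣ Y ∩ Z ∣))
      ≡⟨ ∑-venn contained X Y G ⟩
    op^ true false true b (op^ true true false a H) 0 0
      ≡⟨ op^-omit true b (op^ true true false a H) 0 0 ⟩
    op^ true true false a H 0 0
      ≡⟨ op^-free false a H 0 0 0 ⟩
    pascal a (λ j → H (j ℕ.+ 0) 0) 0
      ≡⟨ pascal-entry a a≤r d+a values ⟩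
    δ a
      ≡⟨ cong (λ S → δ (∣ S ∣)) (∩-comm X (∁ Y)) ⟩
    δ (∣ ∁ Y ∩ X ∣) ∎
    where
    open ≡-Reasoning
    G = weight n r c r
    a = ∣ X ∩ ∁ Y ∣
    b = ∣ ∁ X ∩ Y ∣
    d = ∣ X ∩ Y ∣
    e = ∣ ∁ X ∩ ∁ Y ∣
    H = op^ true false false e (op^ true true true d G)
    d+a : d ℕ.+ a ≡ m ℕ.+ r
    d+a = trans (∣p∩q∣+∣p∩∁q∣ X Y) p
    c+∣∁Y∣ : c ℕ.+ ∣ ∁ Y ∣ ≡ n
    c+∣∁Y∣ = trans (cong (ℕ._+ ∣ ∁ Y ∣) (sym p′)) (∣p∣+∣∁p∣≡n Y)
    -- `X ∖ Y` lies in the complement of `Y`, which has `n - c ≤ r` elements.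
    a≤r : a ≤ r
    a≤r = ℕₚ.≤-trans (subst (_≤ ∣ ∁ Y ∣) (cong ∣_∣ (∩-comm (∁ Y) X)) (∣p∩q∣≤∣p∣ (∁ Y) X))
      (ℕₚ.+-cancelˡ-≤ c _ _ (subst₂ _≤_ (sym c+∣∁Y∣) (ℕₚ.+-comm r c) n≤r+c))
    values : ∀ k v → k ≤ a → k ℕ.+ v ≡ r → H (k ℕ.+ 0) 0 ≡ ι (d C v) * entry m r k
    values k v _ k+v = begin
      H (k ℕ.+ 0) 0
        ≡⟨ op^-omit false e (op^ true true true d G) (k ℕ.+ 0) 0 ⟩
      op^ true true true d G (k ℕ.+ 0) 0
        ≡⟨ op^-concentrated true (weight-at n r c r) (weight-off n r c r) d v (k ℕ.+ 0) 0
             (trans (cong (ℕ._+ v) (ℕₚ.+-identityʳ k)) k+v) ⟩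
      ι (d C v) * MstarEntry n r c (v ℕ.+ 0)
        ≡⟨ cong (ι (d C v) *_) (MstarEntry≡entry {n} {r} {c} {m} {r} {v ℕ.+ 0} {k} (ℕₚ.m≤n⇒m⊔n≡n n≤r+c) refl
             (trans (cong (ℕ._+ k) (ℕₚ.+-identityʳ v)) (trans (ℕₚ.+-comm v k) k+v))) ⟩
      ι (d C v) * entry m r k ∎

-- The four Penrose conditions

theorem2p3 : (r c n : ℕ) → r ≤ c → c ≤ n →
    IsMoorePenroseInverse n r c (inclM n r c) (Mstar n r c)
theorem2p3 r c n r≤c c≤n with ℕₚ.≤-total (r ℕ.+ c) n
-- Here M* is a right inverse of M; the second condition needs reassociation to make the product M
-- M* appear.
... | inj₁ r+c≤n =
    (λ X Y p _ → mul-identityˡ identity (inclM n r c) X Y p)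
  , (λ X Y _ q → trans (mul-assoc c r (Mstar n r c) (inclM n r c) (Mstar n r c) X Y)
                       (mul-identityʳ identity (Mstar n r c) X Y q))
  , M·M*-symmetric n r c
  , M*·M-symmetric n r c
  where
  c≡ : c ∸ r ℕ.+ r ≡ c
  c≡ = ℕₚ.m∸n+n≡m r≤c
  identity : IsIdentity r (M·M* n r c)
  identity = subst₂ (λ n c → IsIdentity r (M·M* n r c))
    (trans (cong (n ∸ c ℕ.+_) c≡) (ℕₚ.m∸n+n≡m c≤n)) c≡
    (M·M*-identity {r} {c ∸ r} {n ∸ c} (ℕₚ.m+n≤o⇒m≤o∸n r r+c≤n))
-- Here M* is a left inverse of M, and it is the first condition that needs reassociation.
... | inj₂ n≤r+c =
    (λ X Y _ q → trans (mul-assoc r c (inclM n r c) (Mstar n r c) (inclM n r c) X Y)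
                       (mul-identityʳ identity (inclM n r c) X Y q))
  , (λ X Y p _ → mul-identityˡ identity (Mstar n r c) X Y p)
  , M·M*-symmetric n r c
  , M*·M-symmetric n r c
  where
  c≡ : c ∸ r ℕ.+ r ≡ c
  c≡ = ℕₚ.m∸n+n≡m r≤c
  identity : IsIdentity c (M*·M n r c)
  identity = subst (λ c → IsIdentity c (M*·M n r c)) c≡
    (M*·M-identity {n} {r} {c ∸ r} (subst (λ c → n ≤ r ℕ.+ c) (sym c≡) n≤r+c))
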